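{- Let $p$ be a prime and let $\theta\in\mathbb{F}_p((X^{ -1}))$ be a counterexample to the $X$-adic Littlewood conjecture over $\mathbb{F}_p$, i.e. $$\inf_{r\geq 0,\ Q\in\mathbb{F}_p[X]\setminus\{0\}} |Q|\cdot\|X^rQ\theta\|\geq c>0$$ for some $c>0$. Then the discrepancy of the two-dimensional van der Corput--Kronecker-type sequence $((\varphi_p(n),\langle \theta n(X)\rangle|_p))_{n\geq 0}$ satisfies $$N D_N\big((\varphi_p(n),\langle \theta n(X)\rangle|_p)\big)=\Omega(\log^2 N),$$ i.e. there is a constant $c'>0$ depending only on $\theta$ and $p$ such that $N D_N\geq c'\log^2 N$ for infinitely many $N\in\mathbb{N}$.
   Context: For $\theta=\sum_{i=j}^\infty a_iX^{ -i}\in\mathbb{F}_p((X^{ -1}))$ with $a_j\neq 0$: $\deg(\theta)=-j$, $|\theta|=2^{ -j}$ (and $|0|=0$), the fractional part is $\langle\theta\rangle=\sum_{i\geq \max\{1,j\}}a_iX^{ -i}$, and $\|\theta\|=|\langle\theta\rangle|$. Elements of $\mathbb{F}_p$ are identified with $\{0,1,\dots,p-1\}$. For $n\in\mathbb{N}_0$ with base-$p$ expansion $n=n_0+n_1p+n_2p^2+\cdots$, set $n(X)=n_0+n_1X+n_2X^2+\cdots\in\mathbb{F}_p[X]$ and $\varphi_p(n)=\sum_{i\geq 0} n_ip^{ -i-1}$ (the van der Corput radical inverse). For a fractional part $\sum_{i\geq 1}b_iX^{ -i}$, the notation $|_p$ means substituting $X=p$, giving the real number $\sum_{i\geq 1}b_ip^{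 -i}\in[0,1)$. The discrepancy of the first $N$ points of a sequence $(\boldsymbol{x}_n)$ in $[0,1)^s$ is $D_N=\sup_J\left|\frac{\#\{0\leq n<N:\boldsymbol{x}_n\in J\}}{N}-\mathrm{vol}(J)\right|$, the supremum over all boxes $J=\prod_{i=1}^s[a_i,b_i)\subseteq[0,1)^s$. -}

module Defs where

open import Data.Nat as ℕ using (ℕ; zero; suc; NonZero; _^_; _%_; _/_)
open import Data.Nat.Properties using (m^n≢0)
open import Data.Integer as ℤ using (ℤ; +_)
open import Data.Fin using (Fin; toℕ; fromℕ)
open import Data.Bool using (Bool; true; false; if_then_else_)
open import Data.Rational as ℚ using (ℚ; 0ℚ; 1ℚ)
open import Data.Product using (Σ; ∃; ∃-syntax; _×_; _,_)
open import Relation.Binary.PropositionalEquality using (_≡_; _≢_)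
open import Relation.Nullary using (¬_)

sumFin : (n : ℕ) → (Fin n → ℕ) → ℕ
sumFin zero f = 0
sumFin (suc n) f = f Fin.zero ℕ.+ sumFin n (λ k → f (Fin.suc k))

sum< : ℕ → (ℕ → ℕ) → ℕ
sum< zero f = 0
sum< (suc n) f = sum< n f ℕ.+ f n

-- An element θ = Σ_{i ≥ j} a_i X^{-i} of F_p((X^{-1})).
-- coeff i is the coefficient a_i of X^{-i} (i ∈ ℤ); only finitely
-- many coefficients with negative index are nonzero.
record Laurent (p : ℕ) : Set where
  field
    coeff  : ℤ → Fin p
    bound  : ℕ
    finite : ∀ i → i ℤ.< ℤ.- (+ bound) → toℕ (coeff i) ≡ 0
open Laurent public

-- A nonzero polynomial Q ∈ F_p[X] of degree deg (so |Q| = 2^deg):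
-- Q = Σ_{k ≤ deg} q_k X^k with q_deg ≠ 0.
record NzPoly (p : ℕ) : Set where
  field
    deg  : ℕ
    q    : Fin (suc deg) → Fin p
    lead : toℕ (q (fromℕ deg)) ≢ 0
open NzPoly public

module _ (p : ℕ) .{{_ : NonZero p}} where

  -- coefficient of X^{-i} in X^r Q θ, as an element of {0,…,p-1}:
  --   Σ_k q_k a_{i+r+k}  (mod p)
  coeffXrQθ : Laurent p → ℕ → NzPoly p → ℕ → ℕ
  coeffXrQθ θ r Q i =
    sumFin (suc (deg Q)) (λ k → toℕ (q Q k) ℕ.* toℕ (coeff θ (+ (i ℕ.+ r ℕ.+ toℕ k)))) % p

  -- |Q| · ‖X^r Q θ‖ ≥ 2^{-K}, i.e. ‖X^r Q θ‖ ≥ 2^{-(deg Q + K)}, i.e. the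
  -- fractional part ⟨X^r Q θ⟩ has a nonzero coefficient at some X^{-i}
  -- with 1 ≤ i ≤ deg Q + K.
  NormBound : Laurent p → ℕ → NzPoly p → ℕ → Set
  NormBound θ r Q K =
    ∃[ i ] (1 ℕ.≤ i × i ℕ.≤ deg Q ℕ.+ K × coeffXrQθ θ r Q i ≢ 0)

  -- θ is a counterexample to the X-adic Littlewood conjecture:
  -- inf_{r ≥ 0, Q ≠ 0} |Q| ‖X^r Q θ‖ ≥ c > 0 for some c; since these
  -- quantities are powers of 2, equivalently ≥ 2^{-K} for some K ∈ ℕ.
  XadicLittlewoodCounterexample : Laurent p → Set
  XadicLittlewoodCounterexample θ =
    ∃[ K ] (∀ (r : ℕ) (Q : NzPoly p) → NormBound θ r Q K)

  digit : ℕ → ℕ → ℕ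
  digit n t = (_/_ n (p ^ t) {{m^n≢0 p t}}) % p

  pinv : ℕ → ℚ
  pinv k = ℚ._/_ (+ 1) (p ^ k) {{m^n≢0 p k}}

  -- van der Corput radical inverse φ_p(n) = Σ_t n_t p^{-t-1}
  -- (digits n_t vanish for t ≥ n since n < p^n)
  vdc : ℕ → ℚ
  vdc n = go (suc n)
    where
      go : ℕ → ℚ
      go zero = 0ℚ
      go (suc t) = go t ℚ.+ (ℚ._/_ (+ digit n t) (p ^ suc t) {{m^n≢0 p (suc t)}})

  -- b_i(n): coefficient of X^{-i} (i ≥ 1) in ⟨θ n(X)⟩, n(X) = Σ_t n_t X^t:
  --   Σ_t n_t a_{i+t}  (mod p)
  kronDigit : Laurent p → ℕ → ℕ → ℕ
  kronDigit θ n i =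
    sum< (suc n) (λ t → digit n t ℕ.* toℕ (coeff θ (+ (i ℕ.+ t)))) % p

  -- partial sums S_k(n) = Σ_{i=1}^{k} b_i(n) p^{-i} of the real number
  -- y_n = ⟨θ n(X)⟩|_p = Σ_{i ≥ 1} b_i(n) p^{-i}
  kronPartial : Laurent p → ℕ → ℕ → ℚ
  kronPartial θ n zero = 0ℚ
  kronPartial θ n (suc k) =
    kronPartial θ n k ℚ.+ (ℚ._/_ (+ kronDigit θ n (suc k)) (p ^ suc k) {{m^n≢0 p (suc k)}})

  -- a ≤ y_n  (y_n is the infimum of the nonincreasing S_k(n) + p^{-k})
  LeKron : ℚ → Laurent p → ℕ → Set
  LeKron a θ n = ∀ k → a ℚ.≤ kronPartial θ n k ℚ.+ pinv k

  KronLt : Laurent p → ℕ → ℚ → Set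
  KronLt θ n b = ∃[ k ] (kronPartial θ n k ℚ.+ pinv k ℚ.< b)

record Box : Set where
  field
    a₁ b₁ a₂ b₂ : ℚ
    0≤a₁ : 0ℚ ℚ.≤ a₁
    a₁≤b₁ : a₁ ℚ.≤ b₁
    b₁≤1 : b₁ ℚ.≤ 1ℚ
    0≤a₂ : 0ℚ ℚ.≤ a₂
    a₂≤b₂ : a₂ ℚ.≤ b₂
    b₂≤1 : b₂ ℚ.≤ 1ℚ
open Box public

vol : Box → ℚ
vol J = (b₁ J ℚ.- a₁ J) ℚ.* (b₂ J ℚ.- a₂ J)

module _ (p : ℕ) .{{_ : NonZero p}} where

  InBox : Laurent p → Box → ℕ → Set
  InBox θ J n =
    (a₁ J ℚ.≤ vdc p n × vdc p n ℚ.< b₁ J) ×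
    (LeKron p (a₂ J) θ n × KronLt p θ n (b₂ J))

  IsIndicator : Laurent p → Box → (N : ℕ) → (Fin N → Bool) → Set
  IsIndicator θ J N S =
    ∀ (n : Fin N) → (S n ≡ true → InBox θ J (toℕ n)) × (InBox θ J (toℕ n) → S n ≡ true)

count : (N : ℕ) → (Fin N → Bool) → ℕ
count zero S = 0
count (suc N) S = (if S Fin.zero then 1 else 0) ℕ.+ count N (λ k → S (Fin.suc k))

toℚ : ℕ → ℚ
toℚ n = ℚ._/_ (+ n) 1

{-# OPTIONS --safe #-}

-- Let ‖X^r Q θ‖ ≥ 2^{-(deg Q + K)} for all r and Q ≠ 0, and let L = 2K + 2.  The range n < N and the
-- box [0,α) × [β₀,β) are cut into cells along the digits of a common centre W: a cell consists of the
-- n that agree with W in all digits above t, in the digits below i, and in the first j digits of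
-- ⟨θ n(X)⟩|_p, and have 0 instead of 1 at the three following positions.
--   * If i + j is below t by more than K, the cell contains exactly the expected number of points: the
--     Hankel matrix of the linear system defining it has independent rows, since a vanishing
--     combination of them is a Q with X^r Q θ too close to a polynomial.
--   * If i + j ≥ t + K, the cell is empty: for a point n in it, n − W is X^i Q with deg Q = t − i, and
--     the first j digits of X^i Q θ vanish.
-- The digits of W at the relevant places are nonzero only on arithmetic progressions of step L, chosen
-- such that i + j − t ≡ K + 1 (mod L).  Hence no cell falls between the two cases, the deficits of the
-- empty cells cannot be compensated, and each of the at least g² cells with i + j = t + K + 1 misses
-- p^{-(K+3)} points, while log N = O(g).  A centre W with these digits exists because the rank
-- statement lets the middle digits of W prescribe any window of digits of ⟨θ W(X)⟩.
module Submission where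

open import Algebra.Properties.Group using (⁻¹-involutive)
open import Defs
open import Data.Bool using (Bool; true; false; if_then_else_)
open import Data.Fin as Fin using (Fin; toℕ; punchIn; punchOut)
open import Data.Fin.Properties as Fin using (all?; ¬∀⟶∃¬; punchIn-punchOut)
import Data.Integer as ℤ
import Data.Integer.Properties as ℤ
open import Data.Nat
open import Data.Nat.Coprimality using (coprime-Bézout; prime⇒coprime)
open import Data.Nat.Divisibility using (divides; m%n≡0⇒n∣m; n∣m⇒m%n≡0)
open import Data.Nat.DivMod
open import Data.Nat.GCD using (module Bézout)
open import Data.Nat.Logarithm using (⌊log₂_⌋; ⌊log₂⌋-mono-≤; ⌊log₂[2^n]⌋≡n)
open import Data.Nat.Primality using (Prime; euclidsLemma; prime⇒nonTrivial)
open import Data.Nat.Properties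
open import Data.Nat.Tactic.RingSolver using (solve-∀)
open import Data.Product using (∃-syntax; _×_; _,_; proj₁; proj₂)
open import Data.Rational as ℚ using (ℚ; 0ℚ; 1ℚ)
import Data.Rational.Properties as ℚ
import Data.Rational.Unnormalised as ℚᵘ
import Data.Rational.Unnormalised.Properties as ℚᵘ
open import Data.Sum using (inj₁; inj₂)
open import Data.Vec.Functional using (insertAt)
open import Data.Vec.Functional.Properties using (insertAt-lookup; insertAt-punchIn)
open import Function using (_∘_)
open import Relation.Binary.Definitions using (tri<; tri≈; tri>)
open import Relation.Binary.PropositionalEquality
open import Relation.Nullary
open import Relation.Nullary.Decidable using (dec-true; dec-false; _×-dec_)

-- Finite sums, indicators and division with remainder.

sum<-cong : ∀ n {f g : ℕ → ℕ} → (∀ k → k < n → f k ≡ g k) → sum< n f ≡ sum< n g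
sum<-cong zero    h = refl
sum<-cong (suc n) h = cong₂ _+_ (sum<-cong n (λ k k<n → h k (m<n⇒m<1+n k<n))) (h n ≤-refl)

sum<-mono : ∀ n {f g : ℕ → ℕ} → (∀ k → k < n → f k ≤ g k) → sum< n f ≤ sum< n g
sum<-mono zero    h = z≤n
sum<-mono (suc n) h = +-mono-≤ (sum<-mono n (λ k k<n → h k (m<n⇒m<1+n k<n))) (h n ≤-refl)

sum<-const : ∀ n c → sum< n (λ _ → c) ≡ n * c
sum<-const zero    c = refl
sum<-const (suc n) c = trans (cong (_+ c) (sum<-const n c)) (+-comm (n * c) c)

sum<-zero : ∀ n {f : ℕ → ℕ} → (∀ k → k < n → f k ≡ 0) → sum< n f ≡ 0
sum<-zero n h = trans (sum<-cong n h) (trans (sum<-const n 0) (*-zeroʳ n))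

sum<-+ : ∀ n (f g : ℕ → ℕ) → sum< n (λ k → f k + g k) ≡ sum< n f + sum< n g
sum<-+ zero    f g = refl
sum<-+ (suc n) f g rewrite sum<-+ n f g = swap (sum< n f) (sum< n g) (f n) (g n)
  where
  swap : ∀ a b c d → a + b + (c + d) ≡ a + c + (b + d)
  swap = solve-∀

sum<-*ˡ : ∀ n c (f : ℕ → ℕ) → sum< n (λ k → c * f k) ≡ c * sum< n f
sum<-*ˡ zero    c f = sym (*-zeroʳ c)
sum<-*ˡ (suc n) c f rewrite sum<-*ˡ n c f = sym (*-distribˡ-+ c (sum< n f) (f n))

sum<-*ʳ : ∀ n c (f : ℕ → ℕ) → sum< n (λ k → f k * c) ≡ sum< n f * c
sum<-*ʳ n c f = trans (sum<-cong n (λ k _ → *-comm (f k) c))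
                      (trans (sum<-*ˡ n c f) (*-comm c (sum< n f)))

sum<-split : ∀ m n (f : ℕ → ℕ) → sum< (m + n) f ≡ sum< m f + sum< n (λ k → f (m + k))
sum<-split m zero    f rewrite +-identityʳ m = sym (+-identityʳ _)
sum<-split m (suc n) f rewrite +-suc m n | sum<-split m n f = +-assoc (sum< m f) _ _

sum<-head : ∀ n (f : ℕ → ℕ) → sum< (suc n) f ≡ f 0 + sum< n (λ k → f (suc k))
sum<-head n f = sum<-split 1 n f

-- For `m` a power of `p` this separates digits: `x` runs over the low ones and `v` over the others.
sum<-blocks : ∀ m c (f : ℕ → ℕ) →
  sum< (m * c) f ≡ sum< c (λ v → sum< m (λ x → f (x + m * v)))
sum<-blocks m zero    f rewrite *-zeroʳ m = refl
sum<-blocks m (suc c) f rewrite *-suc m c | +-comm m (m * c) | sum<-split (m * c) m f =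
  cong₂ _+_ (sum<-blocks m c f) (sum<-cong m (λ x _ → cong f (+-comm (m * c) x)))

sum<-swap : ∀ m n (f : ℕ → ℕ → ℕ) →
  sum< m (λ i → sum< n (f i)) ≡ sum< n (λ j → sum< m (λ i → f i j))
sum<-swap zero    n f = sym (sum<-zero n (λ _ _ → refl))
sum<-swap (suc m) n f rewrite sum<-swap m n f = sym (sum<-+ n _ (f m))

sum<-pick : ∀ n d (f : ℕ → ℕ) → d < n → (∀ k → k < n → k ≢ d → f k ≡ 0) → sum< n f ≡ f d
sum<-pick (suc n) d f d<1+n h with d ≟ n
... | yes refl = cong (_+ f n) (sum<-zero n (λ k k<n → h k (m<n⇒m<1+n k<n) (<⇒≢ k<n)))
... | no d≢n   = trans (cong₂ _+_ (sum<-pick n d f (≤∧≢⇒< (s≤s⁻¹ d<1+n) d≢n)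
                                     (λ k k<n → h k (m<n⇒m<1+n k<n)))
                                  (h n ≤-refl (d≢n ∘ sym)))
                       (+-identityʳ (f d))

sum<-term : ∀ n d (f : ℕ → ℕ) → d < n → f d ≤ sum< n f
sum<-term (suc n) d f d<1+n with d ≟ n
... | yes refl = m≤n+m (f n) _
... | no d≢n   = ≤-trans (sum<-term n d f (≤∧≢⇒< (s≤s⁻¹ d<1+n) d≢n)) (m≤m+n _ (f n))

-- Carries the deficit of a single empty cell through the sum over a row of cells.
sum<-mono-gain : ∀ n d {f g : ℕ → ℕ} D → d < n → (∀ k → k < n → f k ≤ g k) →
  f d + D ≤ g d → sum< n f + D ≤ sum< n g
sum<-mono-gain (suc n) d {f} {g} D d<1+n h gain with d ≟ n
... | yes refl = ≤-trans (≤-reflexive (+-assoc (sum< n f) (f n) D))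
                   (+-mono-≤ (sum<-mono n (λ k k<n → h k (m<n⇒m<1+n k<n))) gain)
... | no d≢n   = ≤-trans (≤-reflexive (swap (sum< n f) (f n) D))
                   (+-mono-≤ (sum<-mono-gain n d D (≤∧≢⇒< (s≤s⁻¹ d<1+n) d≢n)
                                (λ k k<n → h k (m<n⇒m<1+n k<n)) gain)
                             (h n ≤-refl))
  where
  swap : ∀ a b c → a + b + c ≡ a + c + b
  swap = solve-∀

sum<-pos : ∀ n (f : ℕ → ℕ) → 0 < sum< n f → ∃[ k ] (k < n × 0 < f k)
sum<-pos (suc n) f pos with f n in eq
... | suc _ = n , ≤-refl , subst (0 <_) (sym eq) z<s
... | zero  with k , k<n , fk ← sum<-pos n f (subst (0 <_) (+-identityʳ _) pos) =
  k , m<n⇒m<1+n k<n , fk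

sumFin-cong : ∀ n {f g : Fin n → ℕ} → (∀ k → f k ≡ g k) → sumFin n f ≡ sumFin n g
sumFin-cong zero    h = refl
sumFin-cong (suc n) h = cong₂ _+_ (h Fin.zero) (sumFin-cong n (λ k → h (Fin.suc k)))

sumFin-+ : ∀ n (f g : Fin n → ℕ) → sumFin n (λ k → f k + g k) ≡ sumFin n f + sumFin n g
sumFin-+ zero    f g = refl
sumFin-+ (suc n) f g rewrite sumFin-+ n (f ∘ Fin.suc) (g ∘ Fin.suc) = swap (f Fin.zero) (g Fin.zero) _ _
  where
  swap : ∀ a b c d → a + b + (c + d) ≡ a + c + (b + d)
  swap = solve-∀

sumFin-*ʳ : ∀ n c (f : Fin n → ℕ) → sumFin n (λ k → f k * c) ≡ sumFin n f * c
sumFin-*ʳ zero    c f = refl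
sumFin-*ʳ (suc n) c f rewrite sumFin-*ʳ n c (f ∘ Fin.suc) = sym (*-distribʳ-+ c (f Fin.zero) _)

sumFin-remove : ∀ n (i : Fin (suc n)) (f : Fin (suc n) → ℕ) →
  sumFin (suc n) f ≡ f i + sumFin n (f ∘ punchIn i)
sumFin-remove n       Fin.zero    f = refl
sumFin-remove (suc n) (Fin.suc i) f rewrite sumFin-remove n i (f ∘ Fin.suc) =
  swap (f Fin.zero) (f (Fin.suc i)) _
  where
  swap : ∀ a b c → a + (b + c) ≡ b + (a + c)
  swap = solve-∀

sumFin-toℕ : ∀ n (f : ℕ → ℕ) → sumFin n (f ∘ toℕ) ≡ sum< n f
sumFin-toℕ zero    f = refl
sumFin-toℕ (suc n) f = trans (cong (f 0 +_) (sumFin-toℕ n (f ∘ suc))) (sym (sum<-head n f))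

sumFin-snoc : ∀ n (f : Fin (suc n) → ℕ) →
  sumFin (suc n) f ≡ sumFin n (f ∘ Fin.inject₁) + f (Fin.fromℕ n)
sumFin-snoc zero    f = +-identityʳ _
sumFin-snoc (suc n) f rewrite sumFin-snoc n (f ∘ Fin.suc) = sym (+-assoc (f Fin.zero) _ _)

𝟙 : ∀ {ℓ} {P : Set ℓ} → Dec P → ℕ
𝟙 P? = if does P? then 1 else 0

𝟙-yes : ∀ {ℓ} {P : Set ℓ} (P? : Dec P) → P → 𝟙 P? ≡ 1
𝟙-yes P? x = cong (if_then 1 else 0) (dec-true P? x)

𝟙-no : ∀ {ℓ} {P : Set ℓ} (P? : Dec P) → ¬ P → 𝟙 P? ≡ 0
𝟙-no P? ¬x = cong (if_then 1 else 0) (dec-false P? ¬x)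

𝟙-pos : ∀ {ℓ} {P : Set ℓ} (P? : Dec P) → 0 < 𝟙 P? → P
𝟙-pos (yes x) _ = x

𝟙≤1 : ∀ {ℓ} {P : Set ℓ} (P? : Dec P) → 𝟙 P? ≤ 1
𝟙≤1 (yes _) = ≤-refl
𝟙≤1 (no _)  = z≤n

𝟙-cong : ∀ {ℓ ℓ′} {P : Set ℓ} {Q : Set ℓ′} (P? : Dec P) (Q? : Dec Q) →
  (P → Q) → (Q → P) → 𝟙 P? ≡ 𝟙 Q?
𝟙-cong (yes x) Q? to from = sym (𝟙-yes Q? (to x))
𝟙-cong (no ¬x) Q? to from = sym (𝟙-no Q? (¬x ∘ from))

count-toℕ : ∀ N (s : ℕ → Bool) → count N (s ∘ toℕ) ≡ sum< N (λ n → if s n then 1 else 0)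
count-toℕ zero    s = refl
count-toℕ (suc N) s = trans (cong ((if s 0 then 1 else 0) +_) (count-toℕ N (s ∘ suc)))
                            (sym (sum<-head N _))

[x+z*d]/d : ∀ d .{{_ : NonZero d}} x z → (x + z * d) / d ≡ x / d + z
[x+z*d]/d d x z = trans (+-distrib-/-∣ʳ x (divides z refl)) (cong (x / d +_) (m*n/n≡m z d))

[x+d*y]/d : ∀ d .{{_ : NonZero d}} {x} y → x < d → (x + d * y) / d ≡ y
[x+d*y]/d d {x} y x<d = trans (cong (λ w → (x + w) / d) (*-comm d y))
  (trans ([x+z*d]/d d x y) (cong (_+ y) (m<n⇒m/n≡0 x<d)))

-- Base-`p` digits and residues modulo `p`.

module Digits (p : ℕ) .{{_ : NonZero p}} where

  infix 4 _≋_ _≋?_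

  _≋_ : ℕ → ℕ → Set
  x ≋ y = x % p ≡ y % p

  _≋?_ : ∀ x y → Dec (x ≋ y)
  x ≋? y = x % p ≟ y % p

  ≋-+ : ∀ {x x′ y y′} → x ≋ x′ → y ≋ y′ → x + y ≋ x′ + y′
  ≋-+ {x} {x′} {y} {y′} e f = begin
    (x + y) % p              ≡⟨ %-distribˡ-+ x y p ⟩
    (x % p + y % p) % p      ≡⟨ cong₂ (λ a b → (a + b) % p) e f ⟩
    (x′ % p + y′ % p) % p    ≡⟨ %-distribˡ-+ x′ y′ p ⟨
    (x′ + y′) % p            ∎
    where open ≡-Reasoning

  ≋-* : ∀ {x x′ y y′} → x ≋ x′ → y ≋ y′ → x * y ≋ x′ * y′
  ≋-* {x} {x′} {y} {y′} e f = begin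
    (x * y) % p              ≡⟨ %-distribˡ-* x y p ⟩
    (x % p * (y % p)) % p    ≡⟨ cong₂ (λ a b → (a * b) % p) e f ⟩
    (x′ % p * (y′ % p)) % p  ≡⟨ %-distribˡ-* x′ y′ p ⟨
    (x′ * y′) % p            ∎
    where open ≡-Reasoning

  %≋ : ∀ x → x % p ≋ x
  %≋ x = m%n%n≡m%n x p

  +p*≋ : ∀ x z → x + p * z ≋ x
  +p*≋ x z = trans (cong (λ y → (x + y) % p) (*-comm p z)) ([m+kn]%n≡m%n x z p)

  p*≋0 : ∀ z → p * z ≋ 0
  p*≋0 z = +p*≋ 0 z

  -- pred p plays the role of −1.
  neg-cancel : ∀ x → pred p * x + x ≡ p * x
  neg-cancel x = trans (+-comm (pred p * x) x) (cong (_* x) (suc-pred p))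

  ≋-cancelˡ : ∀ x {y z} → x + y ≋ x + z → y ≋ z
  ≋-cancelˡ x {y} {z} e =
    trans (sym (lem y)) (trans (≋-+ {pred p * x} refl e) (lem z))
    where
    lem : ∀ y → pred p * x + (x + y) ≋ y
    lem y = trans (cong (_% p) (trans (sym (+-assoc (pred p * x) x y))
                    (trans (cong (_+ y) (neg-cancel x)) (+-comm (p * x) y))))
                  (+p*≋ y x)

  ≋⇒≡ : ∀ {x y} → x < p → y < p → x ≋ y → x ≡ y
  ≋⇒≡ x<p y<p e = trans (sym (m<n⇒m%n≡m x<p)) (trans e (m<n⇒m%n≡m y<p))

  ≋0⇒%≡0 : ∀ {x} → x ≋ 0 → x % p ≡ 0
  ≋0⇒%≡0 e = trans e (m<n⇒m%n≡m (>-nonZero⁻¹ p))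

  %≡0⇒≋0 : ∀ {x} → x % p ≡ 0 → x ≋ 0
  %≡0⇒≋0 e = trans e (sym (m<n⇒m%n≡m (>-nonZero⁻¹ p)))

  sum<-≋ : ∀ n {f g : ℕ → ℕ} → (∀ k → k < n → f k ≋ g k) → sum< n f ≋ sum< n g
  sum<-≋ zero    h = refl
  sum<-≋ (suc n) h = ≋-+ (sum<-≋ n (λ k k<n → h k (m<n⇒m<1+n k<n))) (h n ≤-refl)

  sumFin-≋ : ∀ n {f g : Fin n → ℕ} → (∀ k → f k ≋ g k) → sumFin n f ≋ sumFin n g
  sumFin-≋ zero    h = refl
  sumFin-≋ (suc n) h = ≋-+ (h Fin.zero) (sumFin-≋ n (λ k → h (Fin.suc k)))

  p^-nonZero : ∀ k → NonZero (p ^ k)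
  p^-nonZero k = m^n≢0 p k

  -- For `u < k` the quotient of `p ^ k * Y` by `p ^ u` still has a factor `p`, which the reduction
  -- modulo `p` discards.
  digit-low : ∀ k {X} Y {u} → u < k → digit p (X + p ^ k * Y) u ≡ digit p X u
  digit-low k {X} Y {u} u<k = begin
    ((X + p ^ k * Y) / p ^ u) {{p^-nonZero u}} % p  ≡⟨ cong (λ z → ((X + z) / p ^ u) {{p^-nonZero u}} % p) pow ⟩
    ((X + z * p ^ u) / p ^ u) {{p^-nonZero u}} % p  ≡⟨ cong (_% p) ([x+z*d]/d (p ^ u) {{p^-nonZero u}} X z) ⟩
    ((X / p ^ u) {{p^-nonZero u}} + z) % p          ≡⟨ +p*≋ _ (p ^ (k ∸ suc u) * Y) ⟩
    (X / p ^ u) {{p^-nonZero u}} % p                ∎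
    where
    open ≡-Reasoning
    z = p * (p ^ (k ∸ suc u) * Y)
    rearr : ∀ a b c d → (a * b) * c * d ≡ a * (c * d) * b
    rearr = solve-∀
    pow : p ^ k * Y ≡ z * p ^ u
    pow = trans (cong (λ e → p ^ e * Y) (sym (m+[n∸m]≡n u<k)))
          (trans (cong (_* Y) (^-distribˡ-+-* p (suc u) (k ∸ suc u)))
                 (rearr p (p ^ u) (p ^ (k ∸ suc u)) Y))

  digit-high : ∀ k {X} Y u → X < p ^ k → digit p (X + p ^ k * Y) (k + u) ≡ digit p Y u
  digit-high k {X} Y u X< = cong (_% p) (begin
    (n / p ^ (k + u)) {{p^-nonZero (k + u)}}
      ≡⟨ /-congʳ {{p^-nonZero (k + u)}} {{nz}} (^-distribˡ-+-* p k u) ⟩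
    (n / (p ^ k * p ^ u)) {{nz}}
      ≡⟨ m/n/o≡m/[n*o] n (p ^ k) (p ^ u) {{p^-nonZero k}} {{p^-nonZero u}} {{nz}} ⟨
    ((n / p ^ k) {{p^-nonZero k}} / p ^ u) {{p^-nonZero u}}
      ≡⟨ cong (λ m → (m / p ^ u) {{p^-nonZero u}}) ([x+d*y]/d (p ^ k) {{p^-nonZero k}} Y X<) ⟩
    (Y / p ^ u) {{p^-nonZero u}} ∎)
    where
    open ≡-Reasoning
    n = X + p ^ k * Y
    nz : NonZero (p ^ k * p ^ u)
    nz = m*n≢0 (p ^ k) (p ^ u) {{p^-nonZero k}} {{p^-nonZero u}}

  digit-zero : ∀ {n u} → n < p ^ u → digit p n u ≡ 0
  digit-zero {n} {u} n< = trans (cong (_% p) (m<n⇒m/n≡0 {{p^-nonZero u}} n<)) (m<n⇒m%n≡m (>-nonZero⁻¹ p))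

  digit<p : ∀ n u → digit p n u < p
  digit<p n u = m%n<n ((n / p ^ u) {{p^-nonZero u}}) p

  dot : ℕ → (ℕ → ℕ) → ℕ → ℕ
  dot n b m = sum< m (λ u → digit p n u * b u)

  dot-cong : ∀ n {b b′} m → (∀ u → b u ≡ b′ u) → dot n b m ≡ dot n b′ m
  dot-cong n m h = sum<-cong m (λ u _ → cong (digit p n u *_) (h u))

  dot-+ : ∀ k m {X} Y b → X < p ^ k →
    dot (X + p ^ k * Y) b (k + m) ≡ dot X b k + dot Y (λ u → b (k + u)) m
  dot-+ k m Y b X< = trans (sum<-split k m _) (cong₂ _+_
    (sum<-cong k (λ u u<k → cong (_* b u) (digit-low k Y u<k)))
    (sum<-cong m (λ u _ → cong (_* b (k + u)) (digit-high k Y u X<))))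

  ^-mono : ∀ {a b} → a ≤ b → p ^ a ≤ p ^ b
  ^-mono = ^-monoʳ-≤ p

  dot-tail : ∀ n b m d → n < p ^ m → dot n b (m + d) ≡ dot n b m
  dot-tail n b m d n< = trans (sum<-split m d _) (trans (cong (dot n b m +_)
    (sum<-zero d (λ k _ → cong (_* b (m + k)) (digit-zero {n} {m + k} (<-≤-trans n< (^-mono (m≤m+n m k)))))))
    (+-identityʳ _))

  dot-length : ∀ n b m m′ → n < p ^ m → n < p ^ m′ → dot n b m ≡ dot n b m′
  dot-length n b m m′ n< n<′ = trans (sym (dot-tail n b m m′ n<))
    (trans (cong (dot n b) (+-comm m m′)) (dot-tail n b m′ m n<′))

  dot-cons : ∀ d v b c → d < p → dot (d + p * v) b (suc c) ≡ d * b 0 + dot v (b ∘ suc) c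
  dot-cons d v b c d<p = begin
    dot (d + p * v) b (suc c)              ≡⟨ cong (λ q → dot (d + q * v) b (suc c)) (sym (*-identityʳ p)) ⟩
    dot (d + p ^ 1 * v) b (1 + c)          ≡⟨ dot-+ 1 c v b (subst (d <_) (sym (*-identityʳ p)) d<p) ⟩
    digit p d 0 * b 0 + dot v (b ∘ suc) c  ≡⟨ cong (λ e → e * b 0 + dot v (b ∘ suc) c) (trans (cong (_% p) (n/1≡n d)) (m<n⇒m%n≡m d<p)) ⟩
    d * b 0 + dot v (b ∘ suc) c            ∎
    where open ≡-Reasoning

  -- Linear independence over F_p in positive form: a nontrivial combination comes with a column
  -- where it does not vanish, which is what the norm bound produces.
  Independent : ∀ c h → (Fin h → ℕ → ℕ) → Set
  Independent c h A = ∀ (q : Fin h → ℕ) → ∃[ r ] (¬ q r ≋ 0) →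
    ∃[ u ] (u < c × ¬ sumFin h (λ r → q r * A r u) ≋ 0)

  -- The vector of unknowns is encoded as the `c` lowest digits of `v`, so that `v < p ^ c` runs
  -- through F_p^c.
  Solves : ∀ c h → (Fin h → ℕ → ℕ) → (Fin h → ℕ) → ℕ → Set
  Solves c h A B v = ∀ r → B r + dot v (A r) c ≋ 0

  solves? : ∀ c h A B v → Dec (Solves c h A B v)
  solves? c h A B v = all? (λ r → (B r + dot v (A r) c) ≋? 0)

-- Linear systems over F_p.

module Prime-Digits (p : ℕ) .{{_ : NonZero p}} (prime : Prime p) where
  open Digits p

  1<p : 1 < p
  1<p = nonTrivial⇒n>1 p {{prime⇒nonTrivial prime}}

  -- Bézout for `p` and `a % p` gives `t` with `t * a` congruent to -1 or to 1, according to the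
  -- sign; the solution is `x * t` or its negative.
  ≋-invert : ∀ {a} → ¬ a ≋ 0 → ∀ x → ∃[ m ] (m < p × x + m * a ≋ 0)
  ≋-invert {a} a≢0 x = m % p , m%n<n m p , trans (≋-+ {x} refl (≋-* (%≋ m) (sym (%≋ a)))) m-ok
    where
    bez : Bézout.Identity 1 p (a % p)
    bez = coprime-Bézout (prime⇒coprime prime {{≢-nonZero (a≢0 ∘ %≡0⇒≋0)}} (m%n<n a p))
    sol : Bézout.Identity 1 p (a % p) → ∃[ m ] (x + m * (a % p) ≋ 0)
    sol (Bézout.+- s t eq) = x * t , trans (cong (_% p) (begin
      x + x * t * (a % p)    ≡⟨ lem x t (a % p) ⟩
      x * (1 + t * (a % p))  ≡⟨ cong (x *_) eq ⟩
      x * (s * p)            ≡⟨ lem′ x s p ⟩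
      p * (x * s)            ∎)) (p*≋0 (x * s))
      where
      open ≡-Reasoning
      lem : ∀ x t b → x + x * t * b ≡ x * (1 + t * b)
      lem = solve-∀
      lem′ : ∀ x s p → x * (s * p) ≡ p * (x * s)
      lem′ = solve-∀
    sol (Bézout.-+ s t eq) = pred p * x * t , trans (cong (_% p) (begin
      x + pred p * x * t * (a % p)                ≡⟨ cong (x +_) (*-assoc (pred p * x) t (a % p)) ⟩
      x + pred p * x * (t * (a % p))              ≡⟨ cong (λ z → x + pred p * x * z) eq ⟨
      x + pred p * x * (1 + s * p)                ≡⟨ lem x (pred p * x) s p ⟩
      pred p * x + x + p * (pred p * x * s)       ≡⟨ cong (_+ p * (pred p * x * s)) (neg-cancel x) ⟩
      p * x + p * (pred p * x * s)                ≡⟨ *-distribˡ-+ p x _ ⟨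
      p * (x + pred p * x * s)                    ∎)) (p*≋0 _)
      where
      open ≡-Reasoning
      lem : ∀ x y s p → x + y * (1 + s * p) ≡ y + x + p * (y * s)
      lem = solve-∀
    m = proj₁ (sol bez)
    m-ok = proj₂ (sol bez)

  *≋0⇒≋0 : ∀ {d a} → ¬ a ≋ 0 → d * a ≋ 0 → d ≋ 0
  *≋0⇒≋0 {d} {a} a≢0 e with euclidsLemma d a prime (m%n≡0⇒n∣m (d * a) p (≋0⇒%≡0 e))
  ... | inj₁ p∣d = %≡0⇒≋0 (n∣m⇒m%n≡0 d p p∣d)
  ... | inj₂ p∣a = contradiction (%≡0⇒≋0 (n∣m⇒m%n≡0 a p p∣a)) a≢0

  -- Cancellation leaves `(m′ ∸ m) * a ≋ 0`, so `p` divides `m′ ∸ m`, which is less than `p`.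
  ≋-invert-unique-≤ : ∀ {a} → ¬ a ≋ 0 → ∀ x {m m′} → m ≤ m′ → m′ < p →
    x + m′ * a ≋ x + m * a → m ≡ m′
  ≋-invert-unique-≤ {a} a≢0 x {m} {m′} m≤m′ m′<p e = ≤-antisym m≤m′ (m∸n≡0⇒m≤n
    (≋⇒≡ (≤-<-trans (m∸n≤m m′ m) m′<p) (>-nonZero⁻¹ p) (*≋0⇒≋0 a≢0 (≋-cancelˡ (m * a) (begin
      (m * a + (m′ ∸ m) * a) % p  ≡⟨ cong (_% p) (sym (*-distribʳ-+ a m (m′ ∸ m))) ⟩
      (m + (m′ ∸ m)) * a % p      ≡⟨ cong (λ k → k * a % p) (m+[n∸m]≡n m≤m′) ⟩
      m′ * a % p                  ≡⟨ ≋-cancelˡ x e ⟩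
      m * a % p                   ≡⟨ cong (_% p) (sym (+-identityʳ (m * a))) ⟩
      (m * a + 0) % p             ∎)))))
    where open ≡-Reasoning

  ≋-invert-unique : ∀ {a} → ¬ a ≋ 0 → ∀ x {m m′} → m < p → m′ < p →
    x + m * a ≋ 0 → x + m′ * a ≋ 0 → m ≡ m′
  ≋-invert-unique a≢0 x {m} {m′} m<p m′<p e e′ with ≤-total m m′
  ... | inj₁ m≤m′ = ≋-invert-unique-≤ a≢0 x m≤m′ m′<p (trans e′ (sym e))
  ... | inj₂ m′≤m = sym (≋-invert-unique-≤ a≢0 x m′≤m m<p (trans e (sym e′)))

  -- One elimination step: rows other than the pivot row r₀ get a multiple of it added so as to
  -- kill the lowest digit, which the pivot row then determines uniquely.
  module Pivot (c h : ℕ) (A : Fin (suc h) → ℕ → ℕ) (B : Fin (suc h) → ℕ)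
               (r₀ : Fin (suc h)) (a≢0 : ¬ A r₀ 0 ≋ 0) where

    mult : Fin h → ℕ
    mult s = proj₁ (≋-invert a≢0 (A (punchIn r₀ s) 0))

    mult-ok : ∀ s → A (punchIn r₀ s) 0 + mult s * A r₀ 0 ≋ 0
    mult-ok s = proj₂ (proj₂ (≋-invert a≢0 (A (punchIn r₀ s) 0)))

    A′ : Fin h → ℕ → ℕ
    A′ s u = A (punchIn r₀ s) (suc u) + mult s * A r₀ (suc u)

    B′ : Fin h → ℕ
    B′ s = B (punchIn r₀ s) + mult s * B r₀

    -- The pivot row receives the coefficient `q₀` for which the combination of the old rows equals
    -- that of the reduced rows. Its column 0 vanishes by `mult-ok`, so the witness column is a
    -- later one and survives in the reduced system.
    independent : Independent (suc c) (suc h) A → Independent c h A′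
    independent ind q (s₁ , q≢0) = go (ind q⁺ (punchIn r₀ s₁ , q≢0 ∘ trans (cong (_% p) (sym (insertAt-punchIn q r₀ q₀ s₁)))))
      where
      q₀ = sumFin h (λ s → q s * mult s)
      q⁺ = insertAt q r₀ q₀

      combine : ∀ u → sumFin (suc h) (λ r → q⁺ r * A r u)
                    ≡ sumFin h (λ s → q s * (A (punchIn r₀ s) u + mult s * A r₀ u))
      combine u = begin
        sumFin (suc h) (λ r → q⁺ r * A r u)
          ≡⟨ sumFin-remove h r₀ (λ r → q⁺ r * A r u) ⟩
        q⁺ r₀ * A r₀ u + sumFin h (λ s → q⁺ (punchIn r₀ s) * A (punchIn r₀ s) u)
          ≡⟨ cong₂ _+_ (cong (_* A r₀ u) (insertAt-lookup q r₀ q₀))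
               (sumFin-cong h (λ s → cong (_* A (punchIn r₀ s) u) (insertAt-punchIn q r₀ q₀ s))) ⟩
        q₀ * A r₀ u + sumFin h (λ s → q s * A (punchIn r₀ s) u)
          ≡⟨ cong (_+ sumFin h (λ s → q s * A (punchIn r₀ s) u)) (sumFin-*ʳ h (A r₀ u) _) ⟨
        sumFin h (λ s → q s * mult s * A r₀ u) + sumFin h (λ s → q s * A (punchIn r₀ s) u)
          ≡⟨ sumFin-+ h _ _ ⟨
        sumFin h (λ s → q s * mult s * A r₀ u + q s * A (punchIn r₀ s) u)
          ≡⟨ sumFin-cong h (λ s → factor (q s) (mult s) (A r₀ u) (A (punchIn r₀ s) u)) ⟩
        sumFin h (λ s → q s * (A (punchIn r₀ s) u + mult s * A r₀ u)) ∎
        where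
        open ≡-Reasoning
        factor : ∀ q m a b → q * m * a + q * b ≡ q * (b + m * a)
        factor = solve-∀

      go : ∃[ u ] (u < suc c × ¬ sumFin (suc h) (λ r → q⁺ r * A r u) ≋ 0) →
           ∃[ u ] (u < c × ¬ sumFin h (λ s → q s * A′ s u) ≋ 0)
      go (suc u , u< , nz) = u , s≤s⁻¹ u< , nz ∘ trans (cong (_% p) (combine (suc u)))
      go (zero  , u< , nz) = contradiction
        (trans (cong (_% p) (combine 0)) (trans
          (sumFin-≋ h {g = λ _ → 0} (λ s → trans (≋-* {q s} refl (mult-ok s)) (cong (_% p) (*-zeroʳ (q s)))))
          (cong (_% p) (sumFin-zero h)))) nz
        where
        sumFin-zero : ∀ n → sumFin n (λ _ → 0) ≡ 0
        sumFin-zero zero    = refl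
        sumFin-zero (suc n) = sumFin-zero n

    -- An equation of the system at `d + p * v`, arranged in the shape `x + m * a` that `≋-invert`
    -- solves for the lowest digit.
    row : ℕ → Fin (suc h) → ℕ → ℕ
    row v r d = (B r + dot v (A r ∘ suc) c) + d * A r 0

    row-eq : ∀ v r d → d < p → B r + dot (d + p * v) (A r) (suc c) ≡ row v r d
    row-eq v r d d<p = trans (cong (B r +_) (dot-cons d v (A r) c d<p)) (lem (B r) (d * A r 0) _)
      where
      lem : ∀ x y z → x + (y + z) ≡ x + z + y
      lem = solve-∀

    row′-eq : ∀ v s → B′ s + dot v (A′ s) c
      ≡ (B (punchIn r₀ s) + dot v (A (punchIn r₀ s) ∘ suc) c) + mult s * (B r₀ + dot v (A r₀ ∘ suc) c)
    row′-eq v s = begin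
      B′ s + dot v (A′ s) c
        ≡⟨ cong (B′ s +_) (sum<-cong c (λ u _ → lem (digit p v u) (A (punchIn r₀ s) (suc u)) (mult s) (A r₀ (suc u)))) ⟩
      B′ s + sum< c (λ u → digit p v u * A (punchIn r₀ s) (suc u) + mult s * (digit p v u * A r₀ (suc u)))
        ≡⟨ cong (B′ s +_) (trans (sum<-+ c _ _) (cong (dot v (A (punchIn r₀ s) ∘ suc) c +_) (sum<-*ˡ c (mult s) _))) ⟩
      B′ s + (dot v (A (punchIn r₀ s) ∘ suc) c + mult s * dot v (A r₀ ∘ suc) c)
        ≡⟨ lem′ (B (punchIn r₀ s)) (mult s) (B r₀) _ _ ⟩
      _ ∎
      where
      open ≡-Reasoning
      lem : ∀ d a m b → d * (a + m * b) ≡ d * a + m * (d * b)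
      lem = solve-∀
      lem′ : ∀ b m b₀ x y → b + m * b₀ + (x + m * y) ≡ b + x + m * (b₀ + y)
      lem′ = solve-∀

    -- Adding `mult s` times the pivot equation, which holds by hypothesis, changes nothing modulo
    -- `p`, and by `mult-ok` it removes the lowest digit.
    row≋row′ : ∀ v d → row v r₀ d ≋ 0 → ∀ s → row v (punchIn r₀ s) d ≋ B′ s + dot v (A′ s) c
    row≋row′ v d e s = begin
      row v s′ d % p                                        ≡⟨ cong (_% p) (sym (trans (cong (row v s′ d +_) (*-zeroʳ (mult s))) (+-identityʳ _))) ⟩
      (row v s′ d + mult s * 0) % p                         ≡⟨ ≋-+ {row v s′ d} refl (≋-* {mult s} refl (sym e)) ⟩
      (row v s′ d + mult s * row v r₀ d) % p                ≡⟨ cong (_% p) (lem X d (A s′ 0) (mult s) Y (A r₀ 0)) ⟩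
      (X + mult s * Y + d * (A s′ 0 + mult s * A r₀ 0)) % p ≡⟨ ≋-+ {X + mult s * Y} refl (trans (≋-* {d} refl (mult-ok s)) (cong (_% p) (*-zeroʳ d))) ⟩
      (X + mult s * Y + 0) % p                              ≡⟨ cong (_% p) (trans (+-identityʳ _) (sym (row′-eq v s))) ⟩
      (B′ s + dot v (A′ s) c) % p                           ∎
      where
      open ≡-Reasoning
      s′ = punchIn r₀ s
      X = B s′ + dot v (A s′ ∘ suc) c
      Y = B r₀ + dot v (A r₀ ∘ suc) c
      lem : ∀ x d a m y b → x + d * a + m * (y + d * b) ≡ x + m * y + d * (a + m * b)
      lem = solve-∀

    -- The pivot equation admits exactly one lowest digit `d₀`; for this digit the other equations
    -- are those of the reduced system.
    fibre : ∀ v → sum< p (λ d → 𝟙 (solves? (suc c) (suc h) A B (d + p * v))) ≡ 𝟙 (solves? c h A′ B′ v)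
    fibre v = trans
      (sum<-pick p d₀ _ d₀<p (λ d d<p d≢d₀ → 𝟙-no (solves? (suc c) (suc h) A B (d + p * v)) (λ sol →
        d≢d₀ (≋-invert-unique a≢0 (B r₀ + dot v (A r₀ ∘ suc) c) d<p d₀<p (trans (cong (_% p) (sym (row-eq v r₀ d d<p))) (sol r₀)) d₀-ok))))
      (𝟙-cong (solves? (suc c) (suc h) A B (d₀ + p * v)) (solves? c h A′ B′ v) to from)
      where
      inv = ≋-invert a≢0 (B r₀ + dot v (A r₀ ∘ suc) c)
      d₀ = proj₁ inv
      d₀<p = proj₁ (proj₂ inv)
      d₀-ok = proj₂ (proj₂ inv)
      to : Solves (suc c) (suc h) A B (d₀ + p * v) → Solves c h A′ B′ v
      to sol s = trans (sym (row≋row′ v d₀ d₀-ok s))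
        (trans (cong (_% p) (sym (row-eq v (punchIn r₀ s) d₀ d₀<p))) (sol (punchIn r₀ s)))
      from : Solves c h A′ B′ v → Solves (suc c) (suc h) A B (d₀ + p * v)
      from sol r with r₀ Fin.≟ r
      ... | yes refl = trans (cong (_% p) (row-eq v r₀ d₀ d₀<p)) d₀-ok
      ... | no r₀≢r  = subst (λ r → B r + dot (d₀ + p * v) (A r) (suc c) ≋ 0) (punchIn-punchOut r₀≢r)
        (trans (cong (_% p) (row-eq v _ d₀ d₀<p)) (trans (row≋row′ v d₀ d₀-ok (punchOut r₀≢r)) (sol (punchOut r₀≢r))))

  -- Induction on the number of unknowns: if column 0 vanishes, the lowest digit is free and
  -- contributes a factor `p`; otherwise a pivot determines it and one equation disappears. The
  -- product form avoids the exponent `c − h`.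
  count-solutions : ∀ c h A B → Independent c h A →
    sum< (p ^ c) (λ v → 𝟙 (solves? c h A B v)) * p ^ h ≡ p ^ c
  count-solutions zero zero A B ind = refl
  -- The combination with all coefficients 1 is nontrivial, but there is no column to witness it.
  count-solutions zero (suc h) A B ind
    with _ , () , _ ← ind (λ _ → 1) (Fin.zero , λ e → contradiction (≋⇒≡ 1<p (>-nonZero⁻¹ p) e) (λ ()))
  count-solutions (suc c) h A B ind with all? (λ r → A r 0 ≋? 0)
  ... | yes col0 = begin
    sum< (p * p ^ c) (λ v → 𝟙 (solves? (suc c) h A B v)) * p ^ h
      ≡⟨ cong (_* p ^ h) (sum<-blocks p (p ^ c) _) ⟩
    sum< (p ^ c) (λ v → sum< p (λ d → 𝟙 (solves? (suc c) h A B (d + p * v)))) * p ^ h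
      ≡⟨ cong (_* p ^ h) (sum<-cong (p ^ c) (λ v _ → trans (sum<-cong p (λ d d<p →
           𝟙-cong (solves? (suc c) h A B (d + p * v)) (solves? c h A₊ B v)
             (λ sol r → trans (sym (same v d d<p r)) (sol r))
             (λ sol r → trans (same v d d<p r) (sol r)))) (sum<-const p _))) ⟩
    sum< (p ^ c) (λ v → p * 𝟙 (solves? c h A₊ B v)) * p ^ h
      ≡⟨ cong (_* p ^ h) (sum<-*ˡ (p ^ c) p _) ⟩
    p * sum< (p ^ c) (λ v → 𝟙 (solves? c h A₊ B v)) * p ^ h
      ≡⟨ *-assoc p _ _ ⟩
    p * (sum< (p ^ c) (λ v → 𝟙 (solves? c h A₊ B v)) * p ^ h)
      ≡⟨ cong (p *_) (count-solutions c h A₊ B ind₊) ⟩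
    p * p ^ c ∎
    where
    open ≡-Reasoning
    A₊ : Fin h → ℕ → ℕ
    A₊ r u = A r (suc u)
    same : ∀ v d → d < p → ∀ r → B r + dot (d + p * v) (A r) (suc c) ≋ B r + dot v (A₊ r) c
    same v d d<p r = ≋-+ {B r} refl (trans (cong (_% p) (dot-cons d v (A r) c d<p))
      (≋-+ {y = dot v (A₊ r) c} (trans (≋-* {d} refl (col0 r)) (cong (_% p) (*-zeroʳ d))) refl))
    ind₊ : Independent c h A₊
    ind₊ q q≢0 with ind q q≢0
    ... | suc u , u< , nz = u , s≤s⁻¹ u< , nz
    ... | zero  , u< , nz = contradiction (trans (sumFin-≋ h {g = λ _ → 0 * 0}
            (λ r → trans (≋-* {q r} refl (col0 r)) (cong (_% p) (*-zeroʳ (q r)))))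
            (cong (_% p) (trans (sumFin-*ʳ h 0 (λ _ → 0)) (*-zeroʳ (sumFin h (λ _ → 0)))))) nz
  count-solutions (suc c) zero A B ind | no ¬col0 = contradiction (λ ()) ¬col0
  count-solutions (suc c) (suc h) A B ind | no ¬col0 = begin
    sum< (p * p ^ c) (λ v → 𝟙 (solves? (suc c) (suc h) A B v)) * (p * p ^ h)
      ≡⟨ cong (_* (p * p ^ h)) (trans (sum<-blocks p (p ^ c) _) (sum<-cong (p ^ c) (λ v _ → fibre v))) ⟩
    sum< (p ^ c) (λ v → 𝟙 (solves? c h A′ B′ v)) * (p * p ^ h)
      ≡⟨ lem (sum< (p ^ c) (λ v → 𝟙 (solves? c h A′ B′ v))) p (p ^ h) ⟩
    p * (sum< (p ^ c) (λ v → 𝟙 (solves? c h A′ B′ v)) * p ^ h)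
      ≡⟨ cong (p *_) (count-solutions c h A′ B′ (independent ind)) ⟩
    p * p ^ c ∎
    where
    open ≡-Reasoning
    pivot = ¬∀⟶∃¬ (suc h) (λ r → A r 0 ≋ 0) (λ r → A r 0 ≋? 0) ¬col0
    open Pivot c h A B (proj₁ pivot) (proj₂ pivot)
    lem : ∀ s p q → s * (p * q) ≡ p * (s * q)
    lem = solve-∀

-- Consequences of the norm bound.

module Counterexample (p : ℕ) .{{_ : NonZero p}} (prime : Prime p) (θ : Laurent p)
  (K : ℕ) (norm-bound : ∀ r Q → NormBound p θ r Q K) where
  open Digits p
  open Prime-Digits p prime

  a : ℕ → ℕ
  a i = toℕ (coeff θ (ℤ.+ i))

  -- Vanishing leading coefficients are stripped until a genuine `NzPoly` remains; a smaller degree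
  -- only strengthens the bound. The index `v` is one less than the exponent `i` in `NormBound`.
  norm-bound-coeffs : ∀ d (f : Fin (suc d) → ℕ) → ∃[ k ] (¬ f k ≋ 0) → ∀ r →
    ∃[ v ] (v < d + K × ¬ sumFin (suc d) (λ k → f k * a (suc v + r + toℕ k)) ≋ 0)
  norm-bound-coeffs d f nz r with f (Fin.fromℕ d) ≋? 0
  ... | no top≢0 = found (norm-bound r Q)
    where
    Q : NzPoly p
    Q = record { deg = d ; q = λ k → Fin.fromℕ< (m%n<n (f k) p)
               ; lead = λ e → top≢0 (%≡0⇒≋0 (trans (sym (Fin.toℕ-fromℕ< (m%n<n (f (Fin.fromℕ d)) p))) e)) }
    found : NormBound p θ r Q K →
      ∃[ v ] (v < d + K × ¬ sumFin (suc d) (λ k → f k * a (suc v + r + toℕ k)) ≋ 0)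
    found (suc v , _ , v< , coeff≢0) = v , v< , λ e → coeff≢0 (≋0⇒%≡0 (trans
      (sumFin-≋ (suc d) (λ k → ≋-* {y = a (suc v + r + toℕ k)}
        (trans (cong (_% p) (Fin.toℕ-fromℕ< (m%n<n (f k) p))) (%≋ (f k))) refl)) e))
  norm-bound-coeffs zero f (Fin.zero , nz) r | yes top≡0 = contradiction top≡0 nz
  norm-bound-coeffs (suc d) f (k₀ , nz) r | yes top≡0 =
    shorten (norm-bound-coeffs d (f ∘ Fin.inject₁) (Fin.lower₁ k₀ k₀≢ , subst (λ k → ¬ f k ≋ 0) (sym (Fin.inject₁-lower₁ k₀ k₀≢)) nz) r)
    where
    k₀≢ : suc d ≢ toℕ k₀
    k₀≢ e = nz (subst (λ k → f k ≋ 0) (Fin.toℕ-injective (trans (Fin.toℕ-fromℕ (suc d)) e)) top≡0)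
    shorten : ∃[ v ] (v < d + K × ¬ sumFin (suc d) (λ k → f (Fin.inject₁ k) * a (suc v + r + toℕ k)) ≋ 0) →
      ∃[ v ] (v < suc d + K × ¬ sumFin (suc (suc d)) (λ k → f k * a (suc v + r + toℕ k)) ≋ 0)
    shorten (v , v< , nz′) = v , m<n⇒m<1+n v< , λ e → nz′ (begin
      sumFin (suc d) (λ k → f (Fin.inject₁ k) * a (suc v + r + toℕ k)) % p
        ≡⟨ cong (_% p) (sumFin-cong (suc d) (λ k → cong (λ i → f (Fin.inject₁ k) * a (suc v + r + i)) (sym (Fin.toℕ-inject₁ k)))) ⟩
      S % p
        ≡⟨ cong (_% p) (sym (+-identityʳ S)) ⟩
      (S + 0) % p
        ≡⟨ ≋-+ {S} refl (sym (≋-* {y = b (Fin.fromℕ (suc d))} top≡0 refl)) ⟩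
      (S + f (Fin.fromℕ (suc d)) * b (Fin.fromℕ (suc d))) % p
        ≡⟨ cong (_% p) (sym (sumFin-snoc (suc d) (λ k → f k * b k))) ⟩
      sumFin (suc (suc d)) (λ k → f k * b k) % p
        ≡⟨ e ⟩
      0 % p ∎)
      where
      open ≡-Reasoning
      b : Fin (suc (suc d)) → ℕ
      b k = a (suc v + r + toℕ k)
      S = sumFin (suc d) (λ k → f (Fin.inject₁ k) * b (Fin.inject₁ k))

  hankel-independent : ∀ s j₀ d c → d + K ≤ c →
    Independent c (suc d) (λ r u → a (suc (j₀ + toℕ r) + (s + u)))
  hankel-independent s j₀ d c d+K≤c q nz with norm-bound-coeffs d q nz (j₀ + s)
  ... | v , v< , nz′ = v , <-≤-trans v< d+K≤c , nz′ ∘ trans (cong (_% p)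
          (sumFin-cong (suc d) (λ k → cong (λ i → q k * a i) (lem v j₀ s (toℕ k)))))
    where
    lem : ∀ v j₀ s k → suc v + (j₀ + s) + k ≡ suc (j₀ + k) + (s + v)
    lem = solve-∀

  -- The digits of the second coordinate, indexed from 0: y n j belongs to X^{-(j+1)}.
  y : ℕ → ℕ → ℕ
  y n j = kronDigit p θ n (suc j)

  y<p : ∀ n j → y n j < p
  y<p n j = m%n<n _ p

  n<p^n : ∀ n → n < p ^ n
  n<p^n zero    = z<s
  n<p^n (suc n) = ≤-trans (s≤s (n<p^n n)) (m<n*m (p ^ n) p {{p^-nonZero n}} 1<p)
    where
    m<n*m : ∀ m n .{{_ : NonZero m}} → 1 < n → m < n * m
    m<n*m m n 1<n = subst (_< n * m) (*-identityˡ m) (*-monoˡ-< m 1<n)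

  y-dot : ∀ n m j → n < p ^ m → y n j ≡ dot n (λ u → a (suc j + u)) m % p
  y-dot n m j n< = cong (_% p) (dot-length n _ (suc n) m (<-trans (n<p^n n) (^-monoʳ-< p 1<p (n<1+n n))) n<)

  y≋dot : ∀ n m j → n < p ^ m → y n j ≋ dot n (λ u → a (suc j + u)) m
  y≋dot n m j n< = trans (cong (_% p) (y-dot n m j n<)) (%≋ _)

  pred≢0 : ¬ pred p ≋ 0
  pred≢0 e = contradiction (≋⇒≡ (≤-reflexive (suc-pred p)) (>-nonZero⁻¹ p) e)
    (λ e → <⇒≢ 1<p (sym (trans (sym (suc-pred p)) (cong suc e))))

  -- `s` is the degree of n(X), found by descending from any bound on the length of `n`.
  top-digit : ∀ m n → n < p ^ m → 0 < n → ∃[ s ] (n < p ^ suc s × ¬ digit p n s ≋ 0)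
  top-digit zero    n n< 0<n = contradiction n< (≤⇒≯ 0<n)
  top-digit (suc m) n n< 0<n with digit p n m ≋? 0
  ... | no  d≢0 = m , n< , d≢0
  ... | yes d≡0 = top-digit m n (m/n≡0⇒m<n {{p^-nonZero m}} (≋⇒≡ (m<n*o⇒m/o<n {{p^-nonZero m}} n<) (>-nonZero⁻¹ p)
                    (trans (sym (%≋ _)) d≡0))) 0<n

  -- An expansion ending in digits p − 1 would make the fractional part of X^R (X − 1) n(X) θ vanish.
  not-all-pred : ∀ n R → ∃[ k ] (R ≤ k × suc (y n k) < p)
  not-all-pred zero R = R , ≤-refl , subst (λ z → suc z < p) (sym (trans (y-dot 0 0 R z<s) (m<n⇒m%n≡m (>-nonZero⁻¹ p)))) 1<p
  not-all-pred n@(suc _) R = go (norm-bound-coeffs (suc s) (f ∘ toℕ) (Fin.fromℕ (suc s) , f-top) R)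
    where
    top = top-digit n n (n<p^n n) z<s
    s = proj₁ top
    n< = proj₁ (proj₂ top)
    -- The coefficients of (X - 1) n(X), with `pred p` for -1.
    f : ℕ → ℕ
    f zero    = pred p * digit p n 0
    f (suc k) = pred p * digit p n (suc k) + digit p n k
    f-top : ¬ f (toℕ (Fin.fromℕ (suc s))) ≋ 0
    f-top e = proj₂ (proj₂ top) (trans (cong (_% p) (sym (trans
      (cong (λ z → pred p * z + digit p n s) (digit-zero {n} {suc s} n<)) (cong (_+ digit p n s) (*-zeroʳ (pred p))))))
      (subst (λ k → f k ≋ 0) (Fin.toℕ-fromℕ (suc s)) e))
    go : ∃[ v ] (v < suc s + K × ¬ sumFin (suc (suc s)) (λ k → f (toℕ k) * a (suc v + R + toℕ k)) ≋ 0) →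
         ∃[ k ] (R ≤ k × suc (y n k) < p)
    -- The nonvanishing coefficient is y_{v+R+1} - y_{v+R}, so these two digits cannot both be
    -- `p − 1`.
    go (v , _ , nz) with suc (y n (v + R)) <? p | suc (y n (suc (v + R))) <? p
    ... | yes lt | _      = v + R , m≤n+m R v , lt
    ... | no _   | yes lt = suc (v + R) , ≤-trans (m≤n+m R v) (n≤1+n _) , lt
    ... | no ge  | no ge′ = contradiction (begin
      sumFin (suc (suc s)) (λ k → f (toℕ k) * b (toℕ k)) % p
        ≡⟨ cong (_% p) (trans (sumFin-toℕ (suc (suc s)) (λ k → f k * b k)) (sum<-head (suc s) _)) ⟩
      (f 0 * b 0 + sum< (suc s) (λ k → f (suc k) * b (suc k))) % p
        ≡⟨ cong (_% p) (cong₂ _+_ (*-assoc (pred p) _ _) (trans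
             (sum<-cong (suc s) (λ k _ → lem (pred p) (digit p n (suc k)) (digit p n k) (b (suc k))))
             (trans (sum<-+ (suc s) _ _) (cong (_+ dot n (b ∘ suc) (suc s)) (sum<-*ˡ (suc s) (pred p) _))))) ⟩
      (pred p * (digit p n 0 * b 0) + (pred p * sum< (suc s) (λ k → digit p n (suc k) * b (suc k)) + dot n (b ∘ suc) (suc s))) % p
        ≡⟨ cong (_% p) (trans (lem′ (pred p) (digit p n 0 * b 0) _ _) (cong (λ z → pred p * z + dot n (b ∘ suc) (suc s)) (sym (sum<-head (suc s) _)))) ⟩
      (pred p * dot n b (suc (suc s)) + dot n (b ∘ suc) (suc s)) % p
        ≡⟨ ≋-+ (≋-* {pred p} refl (trans (sym (y≋dot n (suc (suc s)) (v + R) (<-≤-trans n< (^-mono (n≤1+n (suc s)))))) (cong (_% p) (is-pred (v + R) ge))))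
               (trans (cong (_% p) (dot-cong n (suc s) (λ u → cong a (+-suc (suc (v + R)) u))))
                 (trans (sym (y≋dot n (suc s) (suc (v + R)) n<)) (cong (_% p) (is-pred (suc (v + R)) ge′)))) ⟩
      (pred p * pred p + pred p) % p
        ≡⟨ cong (_% p) (neg-cancel (pred p)) ⟩
      p * pred p % p
        ≡⟨ p*≋0 (pred p) ⟩
      0 % p ∎) nz
      where
      open ≡-Reasoning
      b : ℕ → ℕ
      b k = a (suc v + R + k)
      is-pred : ∀ k → ¬ suc (y n k) < p → y n k ≡ pred p
      is-pred k ge = suc-injective (trans (≤-antisym (y<p n k) (≮⇒≥ ge)) (sym (suc-pred p)))
      lem : ∀ q d e b → (q * d + e) * b ≡ q * (d * b) + e * b
      lem = solve-∀
      lem′ : ∀ q x y z → q * x + (q * y + z) ≡ q * (x + y) + z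
      lem′ = solve-∀

  -- n − W is X^i times a polynomial of degree e, so at most e + K of its leading digits vanish.
  agreement-bound : ∀ i e j n W →
    (∀ u → u < i → digit p n u ≡ digit p W u) →
    (∀ u → i + suc e ≤ u → digit p n u ≡ digit p W u) →
    digit p n (i + e) ≡ 0 → digit p W (i + e) ≡ 1 →
    (∀ u → u < j → y n u ≡ y W u) → ¬ e + K ≤ j
  agreement-bound i e j n W low high n-top W-top agree e+K≤j =
    go (norm-bound-coeffs e (λ k → δ (i + toℕ k)) (Fin.fromℕ e , δ-top) i)
    where
    -- Neither `n` nor `W` has digits from position `m` on, so sums of length `i + suc e + m` see
    -- all of both.
    m = n + W
    -- The coefficients of n(X) - W(X), hence a difference without borrows.
    δ : ℕ → ℕ
    δ u = digit p n u + pred p * digit p W u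
    δ-top : ¬ δ (i + toℕ (Fin.fromℕ e)) ≋ 0
    δ-top rewrite Fin.toℕ-fromℕ e | n-top | W-top | *-identityʳ (pred p) = pred≢0
    δ-same : ∀ u → digit p n u ≡ digit p W u → δ u ≋ 0
    δ-same u eq = trans (cong (_% p) (trans (cong (_+ pred p * digit p W u) eq)
      (trans (+-comm (digit p W u) _) (neg-cancel (digit p W u))))) (p*≋0 (digit p W u))
    go : ∃[ v ] (v < e + K × ¬ sumFin (suc e) (λ k → δ (i + toℕ k) * a (suc v + i + toℕ k)) ≋ 0) → _
    go (v , v< , nz) = nz (begin
      sumFin (suc e) (λ k → δ (i + toℕ k) * a (suc v + i + toℕ k)) % p
        ≡⟨ cong (_% p) (trans (sumFin-cong (suc e) (λ k → cong (λ x → δ (i + toℕ k) * a x) (+-assoc (suc v) i (toℕ k))))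
             (sumFin-toℕ (suc e) (λ k → δ (i + k) * b (i + k)))) ⟩
      sum< (suc e) (λ k → δ (i + k) * b (i + k)) % p
        ≡⟨ cong (_% p) (sym (+-identityʳ _)) ⟩
      (0 + S + 0) % p
        -- The digits agree below `i` and above `i + e`, so the window sum may be completed to the
        -- pairing with all digits of n(X) - W(X).
        ≡⟨ ≋-+ (≋-+ {y = S} (zeros i (λ k → k) (λ u u<i → δ-same u (low u u<i))) refl)
               (zeros m (λ k → i + suc e + k) (λ u _ → δ-same (i + suc e + u) (high (i + suc e + u) (m≤m+n _ u)))) ⟩
      (sum< i (λ u → δ u * b u) + S + sum< m (λ u → δ (i + suc e + u) * b (i + suc e + u))) % p
        ≡⟨ cong (_% p) (trans (cong (_+ sum< m (λ u → δ (i + suc e + u) * b (i + suc e + u))) (sym (sum<-split i (suc e) (λ u → δ u * b u)))) (sym (sum<-split (i + suc e) m (λ u → δ u * b u)))) ⟩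
      sum< l (λ u → δ u * b u) % p
        ≡⟨ cong (_% p) (trans (sum<-cong l (λ u _ → lem (digit p n u) (pred p) (digit p W u) (b u)))
             (trans (sum<-+ l _ _) (cong (dot n b l +_) (sum<-*ˡ l (pred p) _)))) ⟩
      (dot n b l + pred p * dot W b l) % p
        ≡⟨ ≋-+ (trans (sym (y≋dot n l v (<-≤-trans (n<p^n n) (^-mono (≤-trans (m≤m+n n W) (m≤n+m m (i + suc e))))))) (cong (_% p) (agree v (<-≤-trans v< e+K≤j))))
               (≋-* {pred p} refl (sym (y≋dot W l v (<-≤-trans (n<p^n W) (^-mono (≤-trans (m≤n+m W n) (m≤n+m m (i + suc e)))))))) ⟩
      (y W v + pred p * y W v) % p
        ≡⟨ cong (_% p) (trans (+-comm (y W v) _) (neg-cancel (y W v))) ⟩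
      p * y W v % p
        ≡⟨ p*≋0 (y W v) ⟩
      0 % p ∎)
      where
      open ≡-Reasoning
      l = i + suc e + m
      b : ℕ → ℕ
      b u = a (suc v + u)
      S = sum< (suc e) (λ k → δ (i + k) * b (i + k))
      zeros : ∀ k (g : ℕ → ℕ) → (∀ u → u < k → δ (g u) ≋ 0) → 0 ≋ sum< k (λ u → δ (g u) * b (g u))
      zeros k g z = sym (trans (sum<-≋ k {g = λ _ → 0} (λ u u<k → ≋-* {y = b (g u)} (z u u<k) refl)) (cong (_% p) (sum<-zero k (λ _ _ → refl))))
      lem : ∀ d q w b → (d + q * w) * b ≡ d * b + q * (w * b)
      lem = solve-∀

-- Comparison of fractions by cross-multiplication.

ratio-toℚᵘ : ∀ A m → ℚ.toℚᵘ (ℤ.+ A ℚ./ suc m) ℚᵘ.≃ ℚᵘ.mkℚᵘ (ℤ.+ A) m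
ratio-toℚᵘ A m = ℚ.toℚᵘ-fromℚᵘ (ℚᵘ.mkℚᵘ (ℤ.+ A) m)

ratio-mono-≤ : ∀ {A m B n} .{{_ : NonZero m}} .{{_ : NonZero n}} →
  A * n ≤ B * m → ℤ.+ A ℚ./ m ℚ.≤ ℤ.+ B ℚ./ n
ratio-mono-≤ {A} {suc m} {B} {suc n} le = ℚ.toℚᵘ-cancel-≤ (begin
  ℚ.toℚᵘ (ℤ.+ A ℚ./ suc m)  ≃⟨ ratio-toℚᵘ A m ⟩
  ℚᵘ.mkℚᵘ (ℤ.+ A) m         ≤⟨ ℚᵘ.*≤* (subst₂ ℤ._≤_ (ℤ.pos-* A (suc n)) (ℤ.pos-* B (suc m)) (ℤ.+≤+ le)) ⟩
  ℚᵘ.mkℚᵘ (ℤ.+ B) n         ≃⟨ ratio-toℚᵘ B n ⟨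
  ℚ.toℚᵘ (ℤ.+ B ℚ./ suc n)  ∎)
  where open ℚᵘ.≤-Reasoning

ratio-mono-< : ∀ {A m B n} .{{_ : NonZero m}} .{{_ : NonZero n}} →
  A * n < B * m → ℤ.+ A ℚ./ m ℚ.< ℤ.+ B ℚ./ n
ratio-mono-< {A} {suc m} {B} {suc n} lt = ℚ.toℚᵘ-cancel-< (begin-strict
  ℚ.toℚᵘ (ℤ.+ A ℚ./ suc m)  ≃⟨ ratio-toℚᵘ A m ⟩
  ℚᵘ.mkℚᵘ (ℤ.+ A) m         <⟨ ℚᵘ.*<* (subst₂ ℤ._<_ (ℤ.pos-* A (suc n)) (ℤ.pos-* B (suc m)) (ℤ.+<+ lt)) ⟩
  ℚᵘ.mkℚᵘ (ℤ.+ B) n         ≃⟨ ratio-toℚᵘ B n ⟨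
  ℚ.toℚᵘ (ℤ.+ B ℚ./ suc n)  ∎)
  where open ℚᵘ.≤-Reasoning

ratio-cancel-≤ : ∀ {A m B n} .{{_ : NonZero m}} .{{_ : NonZero n}} →
  ℤ.+ A ℚ./ m ℚ.≤ ℤ.+ B ℚ./ n → A * n ≤ B * m
ratio-cancel-≤ {A} {m} {B} {n} le with A * n ≤? B * m
... | yes le′ = le′
... | no ¬le  = contradiction (ℚ.<-≤-trans (ratio-mono-< {B} {n} {A} {m} (≰⇒> ¬le)) le) (ℚ.<-irrefl refl)

ratio-cancel-< : ∀ {A m B n} .{{_ : NonZero m}} .{{_ : NonZero n}} →
  ℤ.+ A ℚ./ m ℚ.< ℤ.+ B ℚ./ n → A * n < B * m
ratio-cancel-< {A} {m} {B} {n} lt with A * n <? B * m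
... | yes lt′ = lt′
... | no ¬lt  = contradiction (ℚ.<-≤-trans lt (ratio-mono-≤ {B} {n} {A} {m} (≮⇒≥ ¬lt))) (ℚ.<-irrefl refl)

ratio-cross-≡ : ∀ {A m B n} .{{_ : NonZero m}} .{{_ : NonZero n}} →
  A * n ≡ B * m → ℤ.+ A ℚ./ m ≡ ℤ.+ B ℚ./ n
ratio-cross-≡ {A} {m} {B} {n} eq = ℚ.≤-antisym (ratio-mono-≤ {A} {m} {B} {n} (≤-reflexive eq))
                                           (ratio-mono-≤ {B} {n} {A} {m} (≤-reflexive (sym eq)))

ratio-+ : ∀ A B m .{{_ : NonZero m}} → ℤ.+ A ℚ./ m ℚ.+ ℤ.+ B ℚ./ m ≡ ℤ.+ (A + B) ℚ./ m
ratio-+ A B (suc m) = ℚ.toℚᵘ-injective (begin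
  ℚ.toℚᵘ (ℤ.+ A ℚ./ suc m ℚ.+ ℤ.+ B ℚ./ suc m)
    ≈⟨ ℚ.toℚᵘ-homo-+ (ℤ.+ A ℚ./ suc m) (ℤ.+ B ℚ./ suc m) ⟩
  ℚ.toℚᵘ (ℤ.+ A ℚ./ suc m) ℚᵘ.+ ℚ.toℚᵘ (ℤ.+ B ℚ./ suc m)
    ≈⟨ ℚᵘ.+-cong (ratio-toℚᵘ A m) (ratio-toℚᵘ B m) ⟩
  ℚᵘ.mkℚᵘ (ℤ.+ A) m ℚᵘ.+ ℚᵘ.mkℚᵘ (ℤ.+ B) m
    ≈⟨ ℚᵘ.*≡* (trans (cong (ℤ._* ℤ.+ suc m) (trans (sym (ℤ.*-distribʳ-+ (ℤ.+ suc m) (ℤ.+ A) (ℤ.+ B)))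
          (cong (ℤ._* ℤ.+ suc m) (sym (ℤ.pos-+ A B)))))
         (trans (ℤ.*-assoc (ℤ.+ (A + B)) (ℤ.+ suc m) (ℤ.+ suc m))
           (cong (ℤ.+ (A + B) ℤ.*_) (sym (ℤ.pos-* (suc m) (suc m)))))) ⟩
  ℚᵘ.mkℚᵘ (ℤ.+ (A + B)) m
    ≈⟨ ratio-toℚᵘ (A + B) m ⟨
  ℚ.toℚᵘ (ℤ.+ (A + B) ℚ./ suc m) ∎)
  where open ℚᵘ.≃-Reasoning

ratio-* : ∀ A m B n .{{_ : NonZero m}} .{{_ : NonZero n}} .{{_ : NonZero (m * n)}} →
  (ℤ.+ A ℚ./ m) ℚ.* (ℤ.+ B ℚ./ n) ≡ ℤ.+ (A * B) ℚ./ (m * n)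
ratio-* A (suc m) B (suc n) = ℚ.toℚᵘ-injective (begin
  ℚ.toℚᵘ ((ℤ.+ A ℚ./ suc m) ℚ.* (ℤ.+ B ℚ./ suc n))
    ≈⟨ ℚ.toℚᵘ-homo-* (ℤ.+ A ℚ./ suc m) (ℤ.+ B ℚ./ suc n) ⟩
  ℚ.toℚᵘ (ℤ.+ A ℚ./ suc m) ℚᵘ.* ℚ.toℚᵘ (ℤ.+ B ℚ./ suc n)
    ≈⟨ ℚᵘ.*-cong (ratio-toℚᵘ A m) (ratio-toℚᵘ B n) ⟩
  ℚᵘ.mkℚᵘ (ℤ.+ A) m ℚᵘ.* ℚᵘ.mkℚᵘ (ℤ.+ B) n
    ≈⟨ ℚᵘ.*≡* (cong (ℤ._* ℤ.+ (suc m * suc n)) (sym (ℤ.pos-* A B))) ⟩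
  ℚᵘ.mkℚᵘ (ℤ.+ (A * B)) (n + m * suc n)
    ≈⟨ ratio-toℚᵘ (A * B) (n + m * suc n) ⟨
  ℚ.toℚᵘ (ℤ.+ (A * B) ℚ./ (suc m * suc n)) ∎)
  where open ℚᵘ.≃-Reasoning

-- Base-`p` expansions of the two coordinates.

module Expansions (p : ℕ) .{{_ : NonZero p}} where
  open Digits p

  frac : ℕ → ℕ → ℚ
  frac A k = ((ℤ.+ A) ℚ./ (p ^ k)) {{m^n≢0 p k}}

  frac-mono-≤ : ∀ {A k B l} → A * p ^ l ≤ B * p ^ k → frac A k ℚ.≤ frac B l
  frac-mono-≤ {A} {k} {B} {l} = ratio-mono-≤ {A} {p ^ k} {B} {p ^ l} {{m^n≢0 p k}} {{m^n≢0 p l}}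

  frac-mono-< : ∀ {A k B l} → A * p ^ l < B * p ^ k → frac A k ℚ.< frac B l
  frac-mono-< {A} {k} {B} {l} = ratio-mono-< {A} {p ^ k} {B} {p ^ l} {{m^n≢0 p k}} {{m^n≢0 p l}}

  frac-cancel-≤ : ∀ {A k B l} → frac A k ℚ.≤ frac B l → A * p ^ l ≤ B * p ^ k
  frac-cancel-≤ {A} {k} {B} {l} = ratio-cancel-≤ {A} {p ^ k} {B} {p ^ l} {{m^n≢0 p k}} {{m^n≢0 p l}}

  frac-cancel-< : ∀ {A k B l} → frac A k ℚ.< frac B l → A * p ^ l < B * p ^ k
  frac-cancel-< {A} {k} {B} {l} = ratio-cancel-< {A} {p ^ k} {B} {p ^ l} {{m^n≢0 p k}} {{m^n≢0 p l}}

  frac-+ : ∀ A B k → frac A k ℚ.+ frac B k ≡ frac (A + B) k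
  frac-+ A B k = ratio-+ A B (p ^ k) {{m^n≢0 p k}}

  frac-shift : ∀ A k j → frac A k ≡ frac (p ^ j * A) (k + j)
  frac-shift A k j = ratio-cross-≡ {A} {p ^ k} {p ^ j * A} {p ^ (k + j)} {{m^n≢0 p k}} {{m^n≢0 p (k + j)}}
    (trans (cong (A *_) (^-distribˡ-+-* p k j)) (lem A (p ^ k) (p ^ j)))
    where
    lem : ∀ a x y → a * (x * y) ≡ y * a * x
    lem = solve-∀

  0≤frac : ∀ A k → 0ℚ ℚ.≤ frac A k
  0≤frac A k = ratio-mono-≤ {0} {1} {A} {p ^ k} {{_}} {{m^n≢0 p k}} z≤n

  val : (ℕ → ℕ) → ℕ → ℕ
  val d zero    = 0
  val d (suc k) = p * val d k + d k

  partial-sum : (d : ℕ → ℕ) (S : ℕ → ℚ) → S 0 ≡ 0ℚ → (∀ k → S (suc k) ≡ S k ℚ.+ frac (d k) (suc k)) →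
    ∀ k → S k ≡ frac (val d k) k
  partial-sum d S S0 S+ zero    = S0
  partial-sum d S S0 S+ (suc k) = trans (S+ k) (trans (cong (ℚ._+ frac (d k) (suc k))
    (trans (partial-sum d S S0 S+ k) (trans (frac-shift (val d k) k 1)
      (cong₂ (λ x l → frac (x * val d k) l) (*-identityʳ p) (+-comm k 1)))))
    (frac-+ (p * val d k) (d k) (suc k)))

  val-cong : ∀ {d e} k → (∀ u → u < k → d u ≡ e u) → val d k ≡ val e k
  val-cong zero    h = refl
  val-cong (suc k) h = cong₂ (λ x y → p * x + y) (val-cong k (λ u u<k → h u (m<n⇒m<1+n u<k))) (h k ≤-refl)

  val-lower : ∀ d k j → p ^ j * val d k ≤ val d (k + j)
  val-lower d k zero    rewrite +-identityʳ k = ≤-reflexive (*-identityˡ _)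
  val-lower d k (suc j) rewrite +-suc k j = begin
    p * p ^ j * val d k    ≡⟨ *-assoc p (p ^ j) _ ⟩
    p * (p ^ j * val d k)  ≤⟨ *-monoʳ-≤ p (val-lower d k j) ⟩
    p * val d (k + j)      ≤⟨ m≤m+n _ _ ⟩
    _                      ∎
    where open ≤-Reasoning

  val-upper : ∀ {d} → (∀ u → d u < p) → ∀ k j → val d (k + j) < p ^ j * suc (val d k)
  val-upper d< k zero    rewrite +-identityʳ k = ≤-reflexive (sym (*-identityˡ _))
  val-upper {d} d< k (suc j) rewrite +-suc k j = begin-strict
    p * val d (k + j) + d (k + j)  <⟨ +-monoʳ-< _ (d< (k + j)) ⟩
    p * val d (k + j) + p          ≡⟨ trans (+-comm _ p) (sym (*-suc p _)) ⟩
    p * suc (val d (k + j))        ≤⟨ *-monoʳ-≤ p (val-upper d< k j) ⟩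
    p * (p ^ j * suc (val d k))    ≡⟨ *-assoc p (p ^ j) _ ⟨
    p * p ^ j * suc (val d k)      ∎
    where open ≤-Reasoning

  -- A last digit below `p − 1` leaves room for one more unit.
  val-upper-strict : ∀ {d} → (∀ u → d u < p) → ∀ k j → suc (d (k + j)) < p →
    suc (val d (k + suc j)) < p ^ suc j * suc (val d k)
  val-upper-strict {d} d< k j lt rewrite +-suc k j = begin-strict
    suc (p * val d (k + j) + d (k + j))  ≡⟨ +-suc _ _ ⟨
    p * val d (k + j) + suc (d (k + j))  <⟨ +-monoʳ-< _ lt ⟩
    p * val d (k + j) + p                ≡⟨ trans (+-comm _ p) (sym (*-suc p _)) ⟩
    p * suc (val d (k + j))              ≤⟨ *-monoʳ-≤ p (val-upper d< k j) ⟩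
    p * (p ^ j * suc (val d k))          ≡⟨ *-assoc p (p ^ j) _ ⟨
    p * p ^ j * suc (val d k)            ∎
    where open ≤-Reasoning

  -- By `val-step` a difference between truncations persists whatever digits follow, so the order of
  -- the values is the lexicographic order of the digits; this and the next lemma read off the
  -- digits.
  val-≡⇒agree : ∀ {d e} → (∀ u → d u < p) → (∀ u → e u < p) → ∀ k → val d k ≡ val e k →
    ∀ u → u < k → d u ≡ e u
  val-<⇒diff : ∀ {d e} → (∀ u → d u < p) → (∀ u → e u < p) → ∀ k → val d k < val e k →
    ∃[ i ] (i < k × (∀ u → u < i → d u ≡ e u) × d i < e i)
  val-step : ∀ {d e} → (∀ u → d u < p) → ∀ k → val d k < val e k → val d (suc k) < val e (suc k)
  val-step {d} {e} d< k lt = begin-strict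
    p * val d k + d k    <⟨ +-monoʳ-< _ (d< k) ⟩
    p * val d k + p      ≡⟨ trans (+-comm _ p) (sym (*-suc p _)) ⟩
    p * suc (val d k)    ≤⟨ *-monoʳ-≤ p lt ⟩
    p * val e k          ≤⟨ m≤m+n _ _ ⟩
    p * val e k + e k    ∎
    where open ≤-Reasoning

  val-≡⇒agree {d} {e} d< e< (suc k) eq u u<1+k with <-cmp (val d k) (val e k)
  ... | tri< lt _ _ = contradiction eq (<⇒≢ (val-step d< k lt))
  ... | tri> _ _ gt = contradiction (sym eq) (<⇒≢ (val-step e< k gt))
  ... | tri≈ _ eq′ _ with u ≟ k
  ...   | yes refl = +-cancelˡ-≡ (p * val d k) _ _ (trans eq (cong (λ x → p * x + e k) (sym eq′)))
  ...   | no u≢k   = val-≡⇒agree d< e< k eq′ u (≤∧≢⇒< (s≤s⁻¹ u<1+k) u≢k)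

  val-<⇒diff {d} {e} d< e< (suc k) lt with <-cmp (val d k) (val e k)
  ... | tri> _ _ gt  = contradiction (<-trans lt (val-step e< k gt)) (<-irrefl refl)
  ... | tri≈ _ eq _  = k , ≤-refl , val-≡⇒agree d< e< k eq ,
        +-cancelˡ-< (p * val d k) _ _ (subst (λ x → val d (suc k) < p * x + e k) (sym eq) lt)
  ... | tri< lt′ _ _ with i , i<k , rest ← val-<⇒diff d< e< k lt′ = i , m<n⇒m<1+n i<k , rest

  diff⇒val-< : ∀ {d e} → (∀ u → d u < p) → ∀ i j → (∀ u → u < i → d u ≡ e u) → d i < e i →
    val d (suc i + j) < val e (suc i + j)
  diff⇒val-< {d} {e} d< i j agree lt = begin-strict
    val d (suc i + j)            <⟨ val-upper d< (suc i) j ⟩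
    p ^ j * suc (val d (suc i))  ≤⟨ *-monoʳ-≤ (p ^ j) (subst (λ x → p * x + d i < p * val e i + e i) (sym (val-cong i agree)) (+-monoʳ-< _ lt)) ⟩
    p ^ j * val e (suc i)        ≤⟨ val-lower e (suc i) j ⟩
    val e (suc i + j)            ∎
    where open ≤-Reasoning

  val<p^ : ∀ {d} → (∀ u → d u < p) → ∀ k → val d k < p ^ k
  val<p^ d< k = subst (val _ k <_) (*-identityʳ (p ^ k)) (val-upper d< 0 k)

  -- Weight of the i-th nonzero digit when the only nonzero digits are those at multiples of suc L′.
  weight : ℕ → ℕ → ℕ → ℕ
  weight L′ q i = p ^ (suc L′ * (q ∸ suc i) + L′)

  weight-shift : ∀ L′ q i → i < q → weight L′ q i * p ^ suc (suc L′ * i) ≡ p ^ (suc L′ * q)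
  weight-shift L′ q i i<q = trans (sym (^-distribˡ-+-* p (suc L′ * (q ∸ suc i) + L′) _)) (cong (p ^_) (begin
    suc L′ * (q ∸ suc i) + L′ + suc (suc L′ * i)  ≡⟨ lem L′ (q ∸ suc i) i ⟩
    suc L′ * (suc i + (q ∸ suc i))                ≡⟨ cong (suc L′ *_) (m+[n∸m]≡n i<q) ⟩
    suc L′ * q                                    ∎))
    where
    open ≡-Reasoning
    lem : ∀ L x i → suc L * x + L + suc (suc L * i) ≡ suc L * (suc i + x)
    lem = solve-∀

  -- Of the digits after position `o`, only the ones at `o`, `o + L`, ... are kept, and the rest are
  -- dropped. This bounds the sides of the box from below, the direction in which a deficit grows.
  sparse-lower : ∀ e o L′ q → (∀ i → i < q → e (o + suc L′ * i) ≡ 1) →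
    p ^ (suc L′ * q) * val e o + sum< q (weight L′ q) ≤ val e (o + suc L′ * q)
  sparse-lower e o L′ zero    h rewrite *-zeroʳ L′ | +-identityʳ o | +-identityʳ (val e o) = ≤-reflexive (+-identityʳ _)
  sparse-lower e o L′ (suc q) h = begin
    p ^ (L * suc q) * V + (sum< q (weight L′ (suc q)) + weight L′ (suc q) q)
      ≡⟨ cong₂ _+_ (cong (_* V) (trans (cong (p ^_) (*-suc L q)) (^-distribˡ-+-* p L (L * q))))
           (cong₂ _+_ (trans (sum<-cong q (λ i i<q → trans (cong (p ^_) (shift i i<q)) (^-distribˡ-+-* p L _)))
                             (sum<-*ˡ q (p ^ L) (weight L′ q)))
                      (cong (p ^_) (trans (cong (λ x → L * x + L′) (n∸n≡0 q)) (cong (_+ L′) (*-zeroʳ L))))) ⟩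
    p ^ L * p ^ (L * q) * V + (p ^ L * S + p ^ L′)
      ≡⟨ lem p (p ^ L′) (p ^ (L * q)) V S ⟩
    p ^ L′ * (p * (p ^ (L * q) * V + S) + 1)
      ≤⟨ *-monoʳ-≤ (p ^ L′) (+-mono-≤ (*-monoʳ-≤ p (sparse-lower e o L′ q (λ i i<q → h i (m<n⇒m<1+n i<q)))) (≤-reflexive (sym (h q ≤-refl)))) ⟩
    p ^ L′ * val e (suc (o + L * q))
      ≤⟨ val-lower e (suc (o + L * q)) L′ ⟩
    val e (suc (o + L * q) + L′)
      ≡⟨ cong (val e) (lem′ o L′ q) ⟩
    val e (o + L * suc q) ∎
    where
    open ≤-Reasoning
    L = suc L′
    V = val e o
    S = sum< q (weight L′ q)
    shift : ∀ i → i < q → L * (suc q ∸ suc i) + L′ ≡ L + (L * (q ∸ suc i) + L′)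
    shift i i<q = trans (cong (λ x → L * x + L′) (sym (suc-pred-∸ q i i<q))) (lem″ L (q ∸ suc i) L′)
      where
      suc-pred-∸ : ∀ q i → i < q → suc (q ∸ suc i) ≡ q ∸ i
      suc-pred-∸ (suc q) zero    _       = refl
      suc-pred-∸ (suc q) (suc i) (s≤s h) = suc-pred-∸ q i h
      lem″ : ∀ L x l → L * suc x + l ≡ L + (L * x + l)
      lem″ = solve-∀
    lem : ∀ p P Q V S → p * P * Q * V + (p * P * S + P) ≡ P * (p * (Q * V + S) + 1)
    lem = solve-∀
    lem′ : ∀ o L q → suc (o + suc L * q) + L ≡ o + suc L * suc q
    lem′ = solve-∀

  -- A truncation is at most the real number, and a truncation plus one unit is at least it. The
  -- case distinction is on which truncation is the longer.
  val-cross : ∀ {d} → (∀ u → d u < p) → ∀ k m → val d k * p ^ m < suc (val d m) * p ^ k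
  val-cross {d} d< k m with ≤-total k m
  ... | inj₁ k≤m = begin-strict
    val d k * p ^ m                      ≡⟨ cong (λ x → val d k * p ^ x) (m+[n∸m]≡n k≤m) ⟨
    val d k * p ^ (k + j)                ≡⟨ cong (val d k *_) (^-distribˡ-+-* p k j) ⟩
    val d k * (p ^ k * p ^ j)            ≡⟨ lem (val d k) (p ^ k) (p ^ j) ⟩
    p ^ j * val d k * p ^ k              <⟨ *-monoˡ-< (p ^ k) {{m^n≢0 p k}} (s≤s (val-lower d k j)) ⟩
    suc (val d (k + j)) * p ^ k          ≡⟨ cong (λ x → suc (val d x) * p ^ k) (m+[n∸m]≡n k≤m) ⟩
    suc (val d m) * p ^ k                ∎
    where
    open ≤-Reasoning
    j = m ∸ k
    lem : ∀ v x y → v * (x * y) ≡ y * v * x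
    lem = solve-∀
  ... | inj₂ m≤k = begin-strict
    val d k * p ^ m                      ≡⟨ cong (λ x → val d x * p ^ m) (m+[n∸m]≡n m≤k) ⟨
    val d (m + j) * p ^ m                <⟨ *-monoˡ-< (p ^ m) {{m^n≢0 p m}} (val-upper d< m j) ⟩
    p ^ j * suc (val d m) * p ^ m        ≡⟨ lem (suc (val d m)) (p ^ m) (p ^ j) ⟨
    suc (val d m) * (p ^ m * p ^ j)      ≡⟨ cong (suc (val d m) *_) (^-distribˡ-+-* p m j) ⟨
    suc (val d m) * p ^ (m + j)          ≡⟨ cong (λ x → suc (val d m) * p ^ x) (m+[n∸m]≡n m≤k) ⟩
    suc (val d m) * p ^ k                ∎
    where
    open ≤-Reasoning
    j = k ∸ m
    lem : ∀ v x y → v * (x * y) ≡ y * v * x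
    lem = solve-∀

  pow-swap : ∀ j v k → p ^ j * v * p ^ k ≡ v * p ^ (k + j)
  pow-swap j v k = trans (lem (p ^ j) v (p ^ k)) (cong (v *_) (sym (^-distribˡ-+-* p k j)))
    where
    lem : ∀ x v y → x * v * y ≡ v * (y * x)
    lem = solve-∀

  -- The local function summed in the definition of vdc cannot be named, so vdc-go is left as a meta to
  -- be solved to it: abstracting suc n and ℚ._+_ turns vdc-unfold into a first-order pattern problem.
  mutual
    vdc-go : ℕ → ℕ → ℚ
    vdc-go n k = _

    vdc-unfold : ∀ n → vdc p (suc n) ≡
      (vdc-go (suc n) n ℚ.+ frac (digit p (suc n) n) (suc n)) ℚ.+ frac (digit p (suc n) (suc n)) (suc (suc n))
    vdc-unfold n with suc n | ℚ._+_
    ... | w | _ = refl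

  vdc-val : ∀ n → vdc p n ≡ frac (val (digit p n) (suc n)) (suc n)
  vdc-val n = partial-sum (digit p n) (vdc-go n) refl (λ _ → refl) (suc n)

  module _ (n : ℕ) (n<p^ : n < p ^ suc n) where
    private
      d = digit p n

      zero-tail : ∀ j → val d (suc n + j) ≡ p ^ j * val d (suc n)
      zero-tail zero    rewrite +-identityʳ n = sym (*-identityˡ _)
      zero-tail (suc j) rewrite +-suc n j = trans
        (cong₂ (λ x y → p * x + y) (zero-tail j) (digit-zero {n} {suc n + j} (<-≤-trans n<p^ (^-mono (m≤m+n (suc n) j)))))
        (trans (+-identityʳ _) (sym (*-assoc p (p ^ j) _)))

    -- Truncating does not increase the value. The comparison takes place at length `suc n + k`,
    -- where φ_p(n) is exact because all further digits of `n` vanish.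
    vdc-<⇒ : ∀ {B k} → vdc p n ℚ.< frac B k → val d k < B
    vdc-<⇒ {B} {k} lt = *-cancelˡ-< (p ^ suc n) _ _ (begin-strict
      p ^ suc n * val d k       ≤⟨ val-lower d k (suc n) ⟩
      val d (k + suc n)         ≡⟨ cong (val d) (+-comm k (suc n)) ⟩
      val d (suc n + k)         ≡⟨ zero-tail k ⟩
      p ^ k * val d (suc n)     ≡⟨ *-comm (p ^ k) _ ⟩
      val d (suc n) * p ^ k     <⟨ frac-cancel-< {val d (suc n)} {suc n} {B} {k} (subst (ℚ._< frac B k) (vdc-val n) lt) ⟩
      B * p ^ suc n             ≡⟨ *-comm B _ ⟩
      p ^ suc n * B             ∎)
      where open ≤-Reasoning

    vdc-<⇐ : ∀ {B k} → val d k < B → vdc p n ℚ.< frac B k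
    vdc-<⇐ {B} {k} lt = subst (ℚ._< frac B k) (sym (vdc-val n)) (frac-mono-< {val d (suc n)} {suc n} {B} {k} (begin-strict
      val d (suc n) * p ^ k     ≡⟨ *-comm _ (p ^ k) ⟩
      p ^ k * val d (suc n)     ≡⟨ zero-tail k ⟨
      val d (suc n + k)         ≡⟨ cong (val d) (+-comm k (suc n)) ⟨
      val d (k + suc n)         <⟨ val-upper (digit<p n) k (suc n) ⟩
      p ^ suc n * suc (val d k) ≤⟨ *-monoʳ-≤ (p ^ suc n) lt ⟩
      p ^ suc n * B             ≡⟨ *-comm B _ ⟨
      B * p ^ suc n             ∎))
      where open ≤-Reasoning

    0≤vdc : 0ℚ ℚ.≤ vdc p n
    0≤vdc = subst (0ℚ ℚ.≤_) (sym (vdc-val n)) (0≤frac (val d (suc n)) (suc n))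

  module _ (θ : Laurent p) (n : ℕ) where
    private
      d : ℕ → ℕ
      d j = kronDigit p θ n (suc j)
      d< : ∀ u → d u < p
      d< u = m%n<n _ p

    kronPartial-val : ∀ k → kronPartial p θ n k ≡ frac (val d k) k
    kronPartial-val = partial-sum d (kronPartial p θ n) refl (λ _ → refl)

    kron-upper : ∀ k → kronPartial p θ n k ℚ.+ pinv p k ≡ frac (suc (val d k)) k
    kron-upper k = trans (cong (ℚ._+ pinv p k) (kronPartial-val k))
      (trans (frac-+ (val d k) 1 k) (cong (λ x → frac x k) (+-comm (val d k) 1)))

    LeKron⇐ : ∀ {B k} → B ≤ val d k → LeKron p (frac B k) θ n
    LeKron⇐ {B} {k} le m = subst (frac B k ℚ.≤_) (sym (kron-upper m))
      (frac-mono-≤ {B} {k} {suc (val d m)} {m} (≤-trans (*-monoˡ-≤ (p ^ m) le) (<⇒≤ (val-cross d< k m))))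

    KronLt⇒ : ∀ {B k} → KronLt p θ n (frac B k) → val d k < B
    KronLt⇒ {B} {k} (m , lt) = *-cancelʳ-< (p ^ m) _ _ (<-trans (val-cross d< k m)
      (frac-cancel-< {suc (val d m)} {m} {B} {k} (subst (ℚ._< frac B k) (kron-upper m) lt)))

    module _ (not-all-pred : ∀ R → ∃[ k ] (R ≤ k × suc (d k) < p)) where
      private
        gap : ∀ k → ∃[ m ] (suc (val d m) * p ^ k < suc (val d k) * p ^ m)
        gap k with k′ , k≤k′ , lt ← not-all-pred k = k + suc j ,
          subst (suc (val d (k + suc j)) * p ^ k <_) (pow-swap (suc j) (suc (val d k)) k)
            (*-monoˡ-< (p ^ k) {{m^n≢0 p k}} (val-upper-strict d< k j (subst (λ x → suc (d x) < p) (sym (m+[n∸m]≡n k≤k′)) lt)))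
          where j = k′ ∸ k

      LeKron⇒ : ∀ {B k} → LeKron p (frac B k) θ n → B ≤ val d k
      LeKron⇒ {B} {k} le with m , lt ← gap k = s≤s⁻¹ (*-cancelʳ-< (p ^ m) B (suc (val d k)) (≤-<-trans
        (frac-cancel-≤ {B} {k} {suc (val d m)} {m} (subst (frac B k ℚ.≤_) (kron-upper m) (le m))) lt))

      KronLt⇐ : ∀ {B k} → val d k < B → KronLt p θ n (frac B k)
      KronLt⇐ {B} {k} v<B with m , lt ← gap k = m , subst (ℚ._< frac B k) (sym (kron-upper m))
        (frac-mono-< {suc (val d m)} {m} {B} {k} (<-≤-trans lt (*-monoˡ-≤ (p ^ m) v<B)))

-- Integers with prescribed digits.

module Digit-Strings (p : ℕ) .{{_ : NonZero p}} where
  open Digits p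

  digit-cons-zero : ∀ d v → d < p → digit p (d + p * v) 0 ≡ d
  digit-cons-zero d v d<p = trans (cong (_% p) (n/1≡n (d + p * v))) (trans (+p*≋ d v) (m<n⇒m%n≡m d<p))

  digit-cons-suc : ∀ d v u → d < p → digit p (d + p * v) (suc u) ≡ digit p v u
  digit-cons-suc d v u d<p = trans (cong (λ q → digit p (d + q * v) (suc u)) (sym (*-identityʳ p)))
    (digit-high 1 v u (subst (d <_) (sym (*-identityʳ p)) d<p))

  -- Least significant digit first, in contrast to `val`.
  fromDigits : (ℕ → ℕ) → ℕ → ℕ
  fromDigits e zero    = 0
  fromDigits e (suc k) = e 0 + p * fromDigits (e ∘ suc) k

  fromDigits<p^ : ∀ {e} → (∀ u → e u < p) → ∀ k → fromDigits e k < p ^ k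
  fromDigits<p^ e< zero    = z<s
  fromDigits<p^ {e} e< (suc k) = begin-strict
    e 0 + p * F    <⟨ +-monoˡ-< (p * F) (e< 0) ⟩
    p + p * F      ≡⟨ *-suc p F ⟨
    p * suc F      ≤⟨ *-monoʳ-≤ p (fromDigits<p^ (λ u → e< (suc u)) k) ⟩
    p * p ^ k      ∎
    where
    open ≤-Reasoning
    F = fromDigits (e ∘ suc) k

  digit-fromDigits : ∀ {e} → (∀ u → e u < p) → ∀ k u → u < k → digit p (fromDigits e k) u ≡ e u
  digit-fromDigits e< (suc k) zero    _       = digit-cons-zero _ _ (e< 0)
  digit-fromDigits e< (suc k) (suc u) (s≤s h) = trans (digit-cons-suc _ _ u (e< 0)) (digit-fromDigits (λ u → e< (suc u)) k u h)

  digits-injective : ∀ k {x x′} → x < p ^ k → x′ < p ^ k →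
    (∀ u → u < k → digit p x u ≡ digit p x′ u) → x ≡ x′
  digits-injective zero (s≤s z≤n) (s≤s z≤n) _ = refl
  digits-injective (suc k) {x} {x′} x< x′< h = trans (cons x) (trans
    (cong₂ (λ d v → d + p * v) d≡ (digits-injective k (quot< x x<) (quot< x′ x′<) (λ u u<k → trans (sym (tail x u)) (trans (h (suc u) (s≤s u<k)) (tail x′ u)))))
    (sym (cons x′)))
    where
    cons : ∀ x → x ≡ x % p + p * (x / p)
    cons x = trans (m≡m%n+[m/n]*n x p) (cong (x % p +_) (*-comm (x / p) p))
    quot< : ∀ x → x < p ^ suc k → x / p < p ^ k
    quot< x x< = m<n*o⇒m/o<n (subst (x <_) (*-comm p (p ^ k)) x<)
    tail : ∀ x u → digit p x (suc u) ≡ digit p (x / p) u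
    tail x u = trans (cong (λ z → digit p z (suc u)) (cons x)) (digit-cons-suc _ _ u (m%n<n x p))
    d≡ : x % p ≡ x′ % p
    d≡ = trans (sym (cong (_% p) (n/1≡n x))) (trans (h 0 z<s) (cong (_% p) (n/1≡n x′)))

-- The range of `n` and the common centre W.

module Construction (p : ℕ) .{{_ : NonZero p}} (prime : Prime p) (θ : Laurent p)
  (K : ℕ) (norm-bound : ∀ r Q → NormBound p θ r Q K) (g : ℕ) where
  open Digits p
  open Prime-Digits p prime
  open Counterexample p prime θ K norm-bound
  open Expansions p
  open Digit-Strings p

  -- `Y = 2g + 1` leaves room for the index 2g - i′ - k whenever i′, k < g. `c` counts the middle
  -- digits of W: `L * Y` for the window of digits to be prescribed and `K` for the rank statement.
  -- `H′` is such that the positions below `T g + L` are `L * g` low ones and these `c` (`T-last`).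
  -- `j₀` is congruent to `H′ + K + 1` modulo `L`.
  L′ L Y c H′ j₀ R : ℕ
  L′ = suc (K + K)
  L  = suc L′
  Y  = suc (g + g)
  c  = L * Y + K
  H′ = L * g + L * (g + g) + K
  j₀ = L * (g + g) + L′
  R  = j₀ + L * Y

  -- With t = T k, i = L * i′ and j = j₀ + L * j′ one has i + j = t + K + 1 + L * (i′ + j′ + k − 2g).
  T : ℕ → ℕ
  T k = H′ + L * (g ∸ k)

  -- The numbers below N fall into blocks `P k + v` with `v < p ^ T k`: they share with N the digits
  -- above `T k` and have 0 instead of 1 at `T k`.
  P : ℕ → ℕ
  P zero    = 0
  P (suc k) = P k + p ^ T k

  N : ℕ
  N = P g

  T-step : ∀ {k} → k < g → T k ≡ T (suc k) + L
  T-step {k} k<g = trans (cong (λ x → H′ + L * x) (sym (lem g k k<g)))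
    (trans (cong (H′ +_) (trans (*-suc L (g ∸ suc k)) (+-comm L _))) (sym (+-assoc H′ _ L)))
    where
    lem : ∀ g k → k < g → suc (g ∸ suc k) ≡ g ∸ k
    lem (suc g) zero    _       = refl
    lem (suc g) (suc k) (s≤s h) = lem g k h

  T-last : T g + L ≡ L * g + c
  T-last = trans (cong (λ x → H′ + L * x + L) (n∸n≡0 g)) (lem K g)
    where
    lem : ∀ K g → let L = suc (suc (K + K)) in
      (L * g + L * (g + g) + K) + L * 0 + L ≡ L * g + (L * suc (g + g) + K)
    lem = solve-∀

  T-index : ∀ {k} → k ≤ g → T k + L * k ≡ H′ + L * g
  T-index {k} k≤g = trans (+-assoc H′ _ _) (cong (H′ +_) (trans (sym (*-distribˡ-+ L (g ∸ k) k)) (cong (L *_) (m∸n+n≡m k≤g))))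

  P-divisible : ∀ k → k ≤ g → ∃[ Z ] (P k ≡ p ^ (T k + L) * Z)
  P-divisible zero    _   = 0 , sym (*-zeroʳ (p ^ (T 0 + L)))
  P-divisible (suc k) k<g with Z , eq ← P-divisible k (<⇒≤ k<g) = p ^ L * Z + 1 , (begin
    P k + p ^ T k                      ≡⟨ cong₂ _+_ (trans eq (cong (_* Z) (^-distribˡ-+-* p (T k) L))) refl ⟩
    p ^ T k * p ^ L * Z + p ^ T k      ≡⟨ lem (p ^ T k) (p ^ L) Z ⟩
    p ^ T k * (p ^ L * Z + 1)          ≡⟨ cong (λ t → p ^ t * (p ^ L * Z + 1)) (T-step k<g) ⟩
    p ^ (T (suc k) + L) * (p ^ L * Z + 1)  ∎)
    where
    open ≡-Reasoning
    lem : ∀ x y z → x * y * z + x ≡ x * (y * z + 1)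
    lem = solve-∀

  -- A geometric tail with remainder: since 2 ≤ `p ^ L`, doubling a term stays below the power that
  -- precedes it. It bounds N from above and keeps W inside the blocks.
  P-bound : ∀ k d → k + d ≤ g → P (k + d) + p ^ (T (k + d) + L) ≤ P k + p ^ (T k + L)
  P-bound k zero    _   rewrite +-identityʳ k = ≤-refl
  P-bound k (suc d) k+d<g rewrite +-suc k d = begin
    P (k + d) + x + p ^ (T (suc (k + d)) + L)  ≡⟨ cong (λ t → P (k + d) + x + p ^ t) (sym (T-step k+d<g)) ⟩
    P (k + d) + x + x                          ≡⟨ lem (P (k + d)) x ⟩
    P (k + d) + x * 2                          ≤⟨ +-monoʳ-≤ (P (k + d)) (*-monoʳ-≤ x (≤-trans 1<p (≤-trans (≤-reflexive (sym (*-identityʳ p))) (^-mono {1} {L} (s≤s z≤n))))) ⟩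
    P (k + d) + x * p ^ L                      ≡⟨ cong (P (k + d) +_) (^-distribˡ-+-* p (T (k + d)) L) ⟨
    P (k + d) + p ^ (T (k + d) + L)            ≤⟨ P-bound k d (<⇒≤ k+d<g) ⟩
    P k + p ^ (T k + L)                        ∎
    where
    open ≤-Reasoning
    x = p ^ T (k + d)
    lem : ∀ a x → a + x + x ≡ a + x * 2
    lem = solve-∀

  P-mono : ∀ k d → P k ≤ P (k + d)
  P-mono k zero    rewrite +-identityʳ k = ≤-refl
  P-mono k (suc d) rewrite +-suc k d = ≤-trans (P-mono k d) (m≤m+n _ _)

  sparse : ℕ → ℕ
  sparse u = 𝟙 (u % L ≟ 0)

  sparse<p : ∀ u → sparse u < p
  sparse<p u = ≤-<-trans (𝟙≤1 (u % L ≟ 0)) 1<p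

  sparse-multiple : ∀ i → sparse (L * i) ≡ 1
  sparse-multiple i = 𝟙-yes (L * i % L ≟ 0) (trans (cong (_% L) (*-comm L i)) (m*n%n≡0 i L))

  -- Only a digit 1 can be undercut, so a point that first falls below W does so on the progression
  -- of step `L`.
  below-sparse : ∀ {x u} → x < sparse u → x ≡ 0 × u ≡ L * (u / L)
  below-sparse {x} {u} lt = n≤0⇒n≡0 (s≤s⁻¹ (<-≤-trans lt (𝟙≤1 (u % L ≟ 0)))) ,
    trans (m≡m%n+[m/n]*n u L) (trans (cong (_+ u / L * L) (𝟙-pos (u % L ≟ 0) (≤-<-trans z≤n lt))) (*-comm (u / L) L))

  module _ (lo : ℕ) {x : ℕ} (x< : x < p ^ lo) (c : ℕ) {v : ℕ} (v< : v < p ^ c) (Z : ℕ) where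
    private
      n = x + p ^ lo * (v + p ^ c * Z)
      n< : n < p ^ (lo + (c + Z))
      n< = begin-strict
        x + p ^ lo * (v + p ^ c * Z)     <⟨ +-monoˡ-< _ x< ⟩
        p ^ lo + p ^ lo * (v + p ^ c * Z)  ≡⟨ *-suc (p ^ lo) _ ⟨
        p ^ lo * suc (v + p ^ c * Z)     ≤⟨ *-monoʳ-≤ (p ^ lo) (begin
          suc v + p ^ c * Z                ≤⟨ +-monoˡ-≤ (p ^ c * Z) v< ⟩
          p ^ c + p ^ c * Z                ≡⟨ *-suc (p ^ c) Z ⟨
          p ^ c * suc Z                    ≤⟨ *-monoʳ-≤ (p ^ c) (n<p^n Z) ⟩
          p ^ c * p ^ Z                    ≡⟨ ^-distribˡ-+-* p c Z ⟨
          p ^ (c + Z)                      ∎) ⟩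
        p ^ lo * p ^ (c + Z)             ≡⟨ ^-distribˡ-+-* p lo (c + Z) ⟨
        p ^ (lo + (c + Z))               ∎
        where open ≤-Reasoning

    -- The contribution of the fixed digits `x` and `Z` to digit `j` of the second coordinate, minus
    -- the desired value `τ`. What remains is linear in the middle digits `v`, with a Hankel row as
    -- coefficients.
    affine-offset : ℕ → ℕ → ℕ
    affine-offset j τ = dot x (λ u → a (suc j + u)) lo + dot Z (λ u → a (suc j + (lo + (c + u)))) Z + pred p * τ

    private
      equation : ∀ j τ → affine-offset j τ + dot v (λ u → a (suc j + (lo + u))) c ≋ y n j + pred p * τ
      equation j τ = trans (cong (_% p) (lem (dot x _ lo) (dot Z _ Z) (pred p * τ) (dot v _ c)))
        (≋-+ {y = pred p * τ} (sym (trans (y≋dot n (lo + (c + Z)) j n<) (cong (_% p) (trans (dot-+ lo (c + Z) (v + p ^ c * Z) _ x<)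
          (cong (dot x _ lo +_) (dot-+ c Z Z _ v<)))))) refl)
        where
        lem : ∀ x z t v → x + z + t + v ≡ x + (v + z) + t
        lem = solve-∀

    y≡⇒affine : ∀ j τ → y n j ≡ τ → affine-offset j τ + dot v (λ u → a (suc j + (lo + u))) c ≋ 0
    y≡⇒affine j τ eq = trans (equation j τ) (trans (cong (λ s → (s + pred p * τ) % p) eq)
      (trans (cong (_% p) (trans (+-comm τ _) (neg-cancel τ))) (p*≋0 τ)))

    affine⇒y≡ : ∀ j τ → τ < p → affine-offset j τ + dot v (λ u → a (suc j + (lo + u))) c ≋ 0 → y n j ≡ τ
    affine⇒y≡ j τ τ< e = ≋⇒≡ (y<p n j) τ< (≋-cancelˡ (pred p * τ) (trans (trans (cong (_% p) (+-comm _ (y n j)))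
      (trans (sym (equation j τ)) e)) (sym (trans (cong (_% p) (neg-cancel τ)) (p*≋0 τ)))))

  -- The low digits of W are those of the abscissa α, the high ones those of N.
  record Centre : Set where
    field
      W       : ℕ
      W-low   : ∀ u → u < L * g → digit p W u ≡ sparse u
      W-y     : ∀ r → r < L * Y → y W (j₀ + r) ≡ sparse r
      W-block : ∀ k → k < g → ∃[ ρ ] (ρ < p ^ T k × W ≡ P k + p ^ T k + ρ)

  E : ℕ → ℕ
  E i = fromDigits sparse i

  -- The low digits are sparse, the high ones come from N, and the `c` middle digits solve the
  -- Hankel system for the window. Since the number of solutions times `p ^ h` is `p ^ c`, a
  -- solution exists.
  centre : Centre
  centre = build (sum<-pos (p ^ c) _ count-pos)
    where
    Z = proj₁ (P-divisible g ≤-refl)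
    N≡ : N ≡ p ^ (L * g + c) * Z
    N≡ = trans (proj₂ (P-divisible g ≤-refl)) (cong (λ t → p ^ t * Z) T-last)
    h = L * Y
    A : Fin h → ℕ → ℕ
    A r u = a (suc (j₀ + toℕ r) + (L * g + u))
    E< : E (L * g) < p ^ (L * g)
    E< = fromDigits<p^ sparse<p (L * g)
    B : Fin h → ℕ
    -- The offset is the same for all middle digits, so it is taken at 0.
    B r = affine-offset (L * g) E< c {0} (>-nonZero⁻¹ (p ^ c) {{m^n≢0 p c}}) Z (j₀ + toℕ r) (sparse (toℕ r))
    count-pos : 0 < sum< (p ^ c) (λ v → 𝟙 (solves? c h A B v))
    -- `g + g + L′ * Y` is `L * Y − 1`, the degree belonging to `L * Y` rows; `c` exceeds the
    -- required number of columns by one.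
    count-pos with sum< (p ^ c) (λ v → 𝟙 (solves? c h A B v)) | count-solutions c h A B
      (hankel-independent (L * g) j₀ (g + g + L′ * Y) c (n≤1+n _))
    ... | suc _ | _ = z<s
    ... | zero  | e = contradiction (sym e) (≢-nonZero⁻¹ (p ^ c) {{m^n≢0 p c}})
    build : ∃[ v ] (v < p ^ c × 0 < 𝟙 (solves? c h A B v)) → Centre
    build (v , v< , pos) = record { W = W ; W-low = W-low ; W-y = W-y ; W-block = W-block }
      where
      open ≤-Reasoning
      W = E (L * g) + p ^ (L * g) * (v + p ^ c * Z)
      W-low : ∀ u → u < L * g → digit p W u ≡ sparse u
      W-low u u< = trans (digit-low (L * g) (v + p ^ c * Z) u<) (digit-fromDigits sparse<p (L * g) u u<)
      W-y : ∀ r → r < L * Y → y W (j₀ + r) ≡ sparse r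
      W-y r r< = subst (λ r → y W (j₀ + r) ≡ sparse r) (Fin.toℕ-fromℕ< r<)
        (affine⇒y≡ (L * g) E< c v< Z (j₀ + toℕ (Fin.fromℕ< r<)) _ (sparse<p (toℕ (Fin.fromℕ< r<)))
          (𝟙-pos (solves? c h A B v) pos (Fin.fromℕ< r<)))
      low = E (L * g) + p ^ (L * g) * v
      low< : low < p ^ (T g + L)
      low< = begin-strict
        E (L * g) + p ^ (L * g) * v    <⟨ +-monoˡ-< _ E< ⟩
        p ^ (L * g) + p ^ (L * g) * v  ≡⟨ *-suc (p ^ (L * g)) v ⟨
        p ^ (L * g) * suc v            ≤⟨ *-monoʳ-≤ (p ^ (L * g)) v< ⟩
        p ^ (L * g) * p ^ c            ≡⟨ ^-distribˡ-+-* p (L * g) c ⟨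
        p ^ (L * g + c)                ≡⟨ cong (p ^_) T-last ⟨
        p ^ (T g + L)                  ∎
      W≡ : W ≡ N + low
      W≡ = trans (lem (E (L * g)) (p ^ (L * g)) v (p ^ c) Z) (cong (_+ low)
        (trans (cong (_* Z) (sym (^-distribˡ-+-* p (L * g) c))) (sym N≡)))
        where
        lem : ∀ e x v y z → e + x * (v + y * z) ≡ x * y * z + (e + x * v)
        lem = solve-∀
      W-block : ∀ k → k < g → ∃[ ρ ] (ρ < p ^ T k × W ≡ P k + p ^ T k + ρ)
      -- The remainder ρ consists of the later terms of N together with `low`, and `P-bound` keeps
      -- this sum below `p ^ T k`.
      W-block k k<g = W ∸ P (suc k) , +-cancelˡ-< (P (suc k)) _ _ (begin-strict
        P (suc k) + (W ∸ P (suc k))        ≡⟨ m+[n∸m]≡n P≤W ⟩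
        W                                  ≡⟨ W≡ ⟩
        N + low                            <⟨ +-monoʳ-< N low< ⟩
        N + p ^ (T g + L)                  ≡⟨ cong (λ i → P i + p ^ (T i + L)) (m+[n∸m]≡n k<g) ⟨
        P (suc k + d) + p ^ (T (suc k + d) + L)  ≤⟨ P-bound (suc k) d (≤-reflexive (m+[n∸m]≡n k<g)) ⟩
        P (suc k) + p ^ (T (suc k) + L)    ≡⟨ cong (λ t → P (suc k) + p ^ t) (T-step k<g) ⟨
        P (suc k) + p ^ T k                ∎) , sym (m+[n∸m]≡n P≤W)
        where
        d = g ∸ suc k
        P≤W : P (suc k) ≤ W
        P≤W = begin
          P (suc k)      ≤⟨ P-mono (suc k) d ⟩
          P (suc k + d)  ≡⟨ cong P (m+[n∸m]≡n k<g) ⟩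
          N              ≤⟨ m≤m+n N low ⟩
          N + low        ≡⟨ W≡ ⟨
          W              ∎

-- Points in a single cell, and the box as a union of cells.

module Cells (p : ℕ) .{{_ : NonZero p}} (prime : Prime p) (θ : Laurent p)
  (K : ℕ) (norm-bound : ∀ r Q → NormBound p θ r Q K) (g : ℕ)
  (centre : Construction.Centre p prime θ K norm-bound g) where
  open Digits p
  open Prime-Digits p prime
  open Counterexample p prime θ K norm-bound
  open Expansions p
  open Digit-Strings p
  open Construction p prime θ K norm-bound g hiding (centre)
  open Centre centre

  target : ℕ → ℕ → ℕ
  target j r = if does (r <? j) then y W r else 0

  target-below : ∀ {j r} → r < j → target j r ≡ y W r
  target-below {j} {r} r<j = cong (if_then y W r else 0) (dec-true (r <? j) r<j)

  target-at : ∀ j → target j j ≡ 0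
  target-at j = cong (if_then y W j else 0) (dec-false (j <? j) (<-irrefl refl))

  target<p : ∀ j r → target j r < p
  target<p j r with does (r <? j)
  ... | true  = y<p W r
  ... | false = >-nonZero⁻¹ p

  E<p^ : ∀ i → E i < p ^ i
  E<p^ = fromDigits<p^ sparse<p

  -- Here i is the position in n, and j the position in ⟨θ n(X)⟩, of the first digit where n is to differ
  -- from W.  The digits of E i below i are those of W, its digit i is 0.
  Cell : ℕ → ℕ → ℕ → Set
  Cell i j n = (∀ (u : Fin (suc i)) → digit p n (toℕ u) ≡ digit p (E i) (toℕ u))
             × (∀ (r : Fin (suc j)) → y n (toℕ r) ≡ target j (toℕ r))

  cell? : ∀ i j n → Dec (Cell i j n)
  cell? i j n = all? (λ u → digit p n (toℕ u) ≟ digit p (E i) (toℕ u))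
          ×-dec all? (λ r → y n (toℕ r) ≟ target j (toℕ r))

  cellCount : ℕ → ℕ → ℕ → ℕ
  cellCount k i j = sum< (p ^ T k) (λ v → 𝟙 (cell? i j (P k + v)))

  -- Of the `T k` free digits the cell fixes the lowest `i + 1`; the other `c` are subject to
  -- `j + 1` Hankel equations, independent because `j + K ≤ c`.
  cellCount-balanced : ∀ k i j c → k < g → suc i + c ≡ T k → j + K ≤ c →
    cellCount k i j * p ^ (suc i + suc j) ≡ p ^ T k
  cellCount-balanced k i j c k<g i+c≡t j+K≤c = begin
    cellCount k i j * p ^ (suc i + suc j)
      ≡⟨ cong₂ _*_ (cong (λ m → sum< m (λ v → 𝟙 (cell? i j (P k + v)))) (trans (cong (p ^_) (sym i+c≡t)) (^-distribˡ-+-* p (suc i) c)))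
                   (^-distribˡ-+-* p (suc i) (suc j)) ⟩
    sum< (p ^ suc i * p ^ c) (λ v → 𝟙 (cell? i j (P k + v))) * (p ^ suc i * p ^ suc j)
      ≡⟨ cong (_* (p ^ suc i * p ^ suc j)) (trans (sum<-blocks (p ^ suc i) (p ^ c) _) (sum<-cong (p ^ c) fibre)) ⟩
    S * (p ^ suc i * p ^ suc j)
      ≡⟨ lem S (p ^ suc i) (p ^ suc j) ⟩
    p ^ suc i * (S * p ^ suc j)
      ≡⟨ cong (p ^ suc i *_) (count-solutions c (suc j) A B (hankel-independent (suc i) 0 j c j+K≤c)) ⟩
    p ^ suc i * p ^ c
      ≡⟨ trans (sym (^-distribˡ-+-* p (suc i) c)) (cong (p ^_) i+c≡t) ⟩
    p ^ T k ∎
    where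
    open ≡-Reasoning
    lem : ∀ s x y → s * (x * y) ≡ x * (s * y)
    lem = solve-∀
    Z₀ = proj₁ (P-divisible k (<⇒≤ k<g))
    Z = p ^ L * Z₀
    P≡ : P k ≡ p ^ suc i * (p ^ c * Z)
    P≡ = trans (proj₂ (P-divisible k (<⇒≤ k<g))) (trans (cong (_* Z₀) (trans (^-distribˡ-+-* p (T k) L)
           (cong (_* p ^ L) (trans (cong (p ^_) (sym i+c≡t)) (^-distribˡ-+-* p (suc i) c)))))
           (lem′ (p ^ suc i) (p ^ c) (p ^ L) Z₀))
      where
      lem′ : ∀ x y l z → x * y * l * z ≡ x * (y * (l * z))
      lem′ = solve-∀
    E< : E i < p ^ suc i
    E< = <-≤-trans (E<p^ i) (^-mono (n≤1+n i))
    A : Fin (suc j) → ℕ → ℕ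
    A r u = a (suc (toℕ r) + (suc i + u))
    B : Fin (suc j) → ℕ
    B r = affine-offset (suc i) E< c {0} (>-nonZero⁻¹ (p ^ c) {{m^n≢0 p c}}) Z (toℕ r) (target j (toℕ r))
    S = sum< (p ^ c) (λ v → 𝟙 (solves? c (suc j) A B v))
    point : ∀ x v → P k + (x + p ^ suc i * v) ≡ x + p ^ suc i * (v + p ^ c * Z)
    point x v = trans (cong (_+ (x + p ^ suc i * v)) P≡) (lem″ x (p ^ suc i) v (p ^ c * Z))
      where
      lem″ : ∀ x y v z → y * z + (x + y * v) ≡ x + y * (v + z)
      lem″ = solve-∀
    fibre : ∀ v → v < p ^ c → sum< (p ^ suc i) (λ x → 𝟙 (cell? i j (P k + (x + p ^ suc i * v)))) ≡ 𝟙 (solves? c (suc j) A B v)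
    fibre v v< = trans
      -- The low digits of a point in the cell are exactly those of `E i`.
      (sum<-pick (p ^ suc i) (E i) _ E< (λ x x< x≢E → 𝟙-no (cell? i j (P k + (x + p ^ suc i * v))) (λ cell →
        x≢E (digits-injective (suc i) x< E< (λ u u< → trans (sym (digit-low (suc i) _ u<))
          (trans (cong (λ n → digit p n u) (sym (point x v)))
            (subst (λ u → digit p (P k + (x + p ^ suc i * v)) u ≡ digit p (E i) u) (Fin.toℕ-fromℕ< u<) (proj₁ cell (Fin.fromℕ< u<)))))))))
      (𝟙-cong (cell? i j (P k + (E i + p ^ suc i * v))) (solves? c (suc j) A B v)
        (λ cell r → y≡⇒affine (suc i) E< c v< Z (toℕ r) (target j (toℕ r))
          (trans (cong (λ n → y n (toℕ r)) (sym (point (E i) v))) (proj₂ cell r)))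
        (λ sol → (λ u → trans (cong (λ n → digit p n (toℕ u)) (point (E i) v)) (digit-low (suc i) _ (Fin.toℕ<n u)))
               , (λ r → trans (cong (λ n → y n (toℕ r)) (point (E i) v))
                   (affine⇒y≡ (suc i) E< c v< Z (toℕ r) (target j (toℕ r)) (target<p j (toℕ r)) (sol r)))))

  -- The hypotheses of `agreement-bound` have three sources: agreement below `i` and in the first
  -- `j` digits of the second coordinate comes from the cell, agreement above `T k` from the block,
  -- and 0 against 1 at `T k` from `W-block`.
  cellCount-empty : ∀ k i j e → k < g → i ≤ L * g → i + e ≡ T k → e + K ≤ j → cellCount k i j ≡ 0
  cellCount-empty k i j e k<g i≤ i+e≡t e+K≤j = sum<-zero (p ^ T k) (λ v v< → 𝟙-no (cell? i j (P k + v)) (λ cell →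
    agreement-bound i e j (P k + v) W
      (λ u u<i → trans (cell-digit v cell u (m<n⇒m<1+n u<i))
        (trans (digit-fromDigits sparse<p i u u<i) (sym (W-low u (<-≤-trans u<i i≤)))))
      (λ u u≥ → high v v< u (subst (_≤ u) (trans (+-suc i e) (cong suc i+e≡t)) u≥))
      (trans (cong (digit p (P k + v)) i+e≡t) (n-top v v<))
      (trans (cong (digit p W) i+e≡t) W-top)
      (λ u u<j → trans (cell-y v cell u (m<n⇒m<1+n u<j)) (target-below u<j))
      e+K≤j))
    where
    t = T k
    cell-digit : ∀ v → Cell i j (P k + v) → ∀ u → u < suc i → digit p (P k + v) u ≡ digit p (E i) u
    cell-digit v cell u u< = subst (λ u → digit p (P k + v) u ≡ digit p (E i) u) (Fin.toℕ-fromℕ< u<) (proj₁ cell (Fin.fromℕ< u<))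
    cell-y : ∀ v → Cell i j (P k + v) → ∀ r → r < suc j → y (P k + v) r ≡ target j r
    cell-y v cell r r< = subst (λ r → y (P k + v) r ≡ target j r) (Fin.toℕ-fromℕ< r<) (proj₂ cell (Fin.fromℕ< r<))
    Z₀ = proj₁ (P-divisible k (<⇒≤ k<g))
    Z = p ^ L′ * Z₀
    P≡ : P k ≡ p ^ suc t * Z
    P≡ = trans (proj₂ (P-divisible k (<⇒≤ k<g))) (trans (cong (λ x → p ^ x * Z₀) (+-suc t L′))
           (trans (cong (_* Z₀) (^-distribˡ-+-* p (suc t) L′)) (*-assoc (p ^ suc t) (p ^ L′) Z₀)))
    ρ = proj₁ (W-block k k<g)
    ρ< = proj₁ (proj₂ (W-block k k<g))
    W≡ : W ≡ p ^ t + ρ + p ^ suc t * Z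
    W≡ = trans (proj₂ (proj₂ (W-block k k<g))) (trans (cong (λ x → x + p ^ t + ρ) P≡) (lem (p ^ suc t * Z) (p ^ t) ρ))
      where
      lem : ∀ x y z → x + y + z ≡ y + z + x
      lem = solve-∀
    n≡ : ∀ v → P k + v ≡ v + p ^ suc t * Z
    n≡ v = trans (+-comm (P k) v) (cong (v +_) P≡)
    p^t<p^1+t : p ^ t < p ^ suc t
    p^t<p^1+t = ^-monoʳ-< p 1<p (n<1+n t)
    W-low< : p ^ t + ρ < p ^ suc t
    W-low< = <-≤-trans (+-monoʳ-< (p ^ t) ρ<) (≤-trans (≤-reflexive (cong (p ^ t +_) (sym (+-identityʳ (p ^ t))))) (*-monoˡ-≤ (p ^ t) 1<p))
    high : ∀ v → v < p ^ t → ∀ u → suc t ≤ u → digit p (P k + v) u ≡ digit p W u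
    high v v< u t<u = begin
      digit p (P k + v) u                               ≡⟨ cong₂ (digit p) (n≡ v) (sym (m+[n∸m]≡n t<u)) ⟩
      digit p (v + p ^ suc t * Z) (suc t + (u ∸ suc t)) ≡⟨ digit-high (suc t) Z (u ∸ suc t) (<-trans v< p^t<p^1+t) ⟩
      digit p Z (u ∸ suc t)                             ≡⟨ digit-high (suc t) Z (u ∸ suc t) W-low< ⟨
      digit p (p ^ t + ρ + p ^ suc t * Z) (suc t + (u ∸ suc t)) ≡⟨ cong₂ (digit p) W≡ (sym (m+[n∸m]≡n t<u)) ⟨
      digit p W u                                       ∎
      where open ≡-Reasoning
    n-top : ∀ v → v < p ^ t → digit p (P k + v) t ≡ 0
    n-top v v< = trans (cong (λ n → digit p n t) (n≡ v)) (trans (digit-low (suc t) Z (n<1+n t)) (digit-zero {v} {t} v<))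
    W-top : digit p W t ≡ 1
    W-top = begin
      digit p W t                            ≡⟨ cong (λ n → digit p n t) W≡ ⟩
      digit p (p ^ t + ρ + p ^ suc t * Z) t  ≡⟨ digit-low (suc t) Z (n<1+n t) ⟩
      digit p (p ^ t + ρ) t                  ≡⟨ cong₂ (digit p) (trans (+-comm (p ^ t) ρ) (cong (ρ +_) (sym (*-identityʳ (p ^ t))))) (sym (+-identityʳ t)) ⟩
      digit p (ρ + p ^ t * 1) (t + 0)        ≡⟨ digit-high t 1 0 ρ< ⟩
      digit p 1 0                            ≡⟨ cong (_% p) (n/1≡n 1) ⟩
      1 % p                                  ≡⟨ m<n⇒m%n≡m 1<p ⟩
      1                                      ∎
      where open ≡-Reasoning

  -- The sides of the box are truncations of the coordinates of W itself: α after `L * g` digits, β₀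
  -- after `j₀` and β after `R` digits.
  x-bound y-lower y-upper : ℕ
  x-bound = val (digit p W) (L * g)
  y-lower = val (y W) j₀
  y-upper = val (y W) R

  InDigitBox : ℕ → Set
  InDigitBox n = val (digit p n) (L * g) < x-bound × (y-lower ≤ val (y n) j₀ × val (y n) R < y-upper)

  inDigitBox? : ∀ n → Dec (InDigitBox n)
  inDigitBox? n = (val (digit p n) (L * g) <? x-bound) ×-dec ((y-lower ≤? val (y n) j₀) ×-dec (val (y n) R <? y-upper))

  -- The cell is given by the first position in each coordinate where `n` falls below W. By
  -- `below-sparse` it lies on the progression; in the second coordinate it is not before `j₀`, as
  -- the point would then lie below β₀.
  box⇒cell : ∀ n → InDigitBox n → ∃[ i ] ∃[ j ] (i < g × j < Y × Cell (L * i) (j₀ + L * j) n)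
  box⇒cell n (x< , y≥ , y<) = i₀ / L , r / L ,
    *-cancelˡ-< L _ _ (subst (_< L * g) i≡ i<) , *-cancelˡ-< L _ _ (subst (_< L * Y) r≡ r<) ,
    (λ u → cell-x u) , (λ s → cell-y s)
    where
    xd = val-<⇒diff (digit<p n) (digit<p W) (L * g) x<
    i₀ = proj₁ xd
    i< = proj₁ (proj₂ xd)
    x-agree = proj₁ (proj₂ (proj₂ xd))
    x-below = below-sparse {digit p n i₀} {i₀} (subst (digit p n i₀ <_) (W-low i₀ i<) (proj₂ (proj₂ (proj₂ xd))))
    i≡ = proj₂ x-below
    yd = val-<⇒diff (y<p n) (y<p W) R y<
    j = proj₁ yd
    y-agree = proj₁ (proj₂ (proj₂ yd))
    j≥ : j₀ ≤ j
    j≥ with j₀ ≤? j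
    ... | yes le = le
    ... | no ¬le = contradiction (subst (λ x → val (y n) x < val (y W) x) (m+[n∸m]≡n (≰⇒> ¬le))
                     (diff⇒val-< (y<p n) j (j₀ ∸ suc j) y-agree (proj₂ (proj₂ (proj₂ yd))))) (≤⇒≯ y≥)
    r = j ∸ j₀
    j≡ : j₀ + r ≡ j
    j≡ = m+[n∸m]≡n j≥
    r< : r < L * Y
    r< = +-cancelˡ-< j₀ _ _ (subst (_< R) (sym j≡) (proj₁ (proj₂ yd)))
    y-below = below-sparse {y n j} {r} (subst (y n j <_) (trans (cong (y W) (sym j≡)) (W-y r r<)) (proj₂ (proj₂ (proj₂ yd))))
    r≡ = proj₂ y-below
    j≡′ : j₀ + L * (r / L) ≡ j
    j≡′ = trans (cong (j₀ +_) (sym r≡)) j≡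
    cell-x : ∀ (u : Fin (suc (L * (i₀ / L)))) → digit p n (toℕ u) ≡ digit p (E (L * (i₀ / L))) (toℕ u)
    cell-x u rewrite sym i≡ with toℕ u ≟ i₀
    ... | yes e  rewrite e = trans (proj₁ x-below) (sym (digit-zero {E i₀} {i₀} (E<p^ i₀)))
    ... | no u≢ = trans (x-agree (toℕ u) u<) (trans (W-low (toℕ u) (<-trans u< i<)) (sym (digit-fromDigits sparse<p i₀ (toℕ u) u<)))
      where
      u< : toℕ u < i₀
      u< = ≤∧≢⇒< (s≤s⁻¹ (Fin.toℕ<n u)) u≢
    cell-y : ∀ (s : Fin (suc (j₀ + L * (r / L)))) → y n (toℕ s) ≡ target (j₀ + L * (r / L)) (toℕ s)
    cell-y s rewrite j≡′ with toℕ s ≟ j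
    ... | yes e rewrite e = trans (proj₁ y-below) (sym (target-at j))
    ... | no s≢ = trans (y-agree (toℕ s) s<) (sym (target-below s<))
      where
      s< : toℕ s < j
      s< = ≤∧≢⇒< (s≤s⁻¹ (Fin.toℕ<n s)) s≢

-- Summation over the cells.

module Counting (p : ℕ) .{{_ : NonZero p}} (prime : Prime p) (θ : Laurent p)
  (K : ℕ) (norm-bound : ∀ r Q → NormBound p θ r Q K) (g : ℕ)
  (centre : Construction.Centre p prime θ K norm-bound g) where
  open Digits p
  open Prime-Digits p prime
  open Counterexample p prime θ K norm-bound
  open Expansions p
  open Construction p prime θ K norm-bound g hiding (centre)
  open Centre centre
  open Cells p prime θ K norm-bound g centre

  -- Clearing denominators: `D` is that of the area of the box, and `Q` that of the expected number
  -- of points in a diagonal cell. `X` and `Z` are the numerators of the side lengths contributed by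
  -- the sparse digits.
  D Q X Z : ℕ
  D = p ^ (L * g) * p ^ R
  Q = p ^ (K + 3)
  X = sum< g (weight L′ g)
  Z = sum< Y (weight L′ Y)

  boxCount : ℕ
  boxCount = sum< N (λ n → 𝟙 (inDigitBox? n))

  S : ℕ → ℕ → ℕ → ℕ
  S k i j = cellCount k (L * i) (j₀ + L * j)

  sum<-P : ∀ k f → sum< (P k) f ≡ sum< k (λ k → sum< (p ^ T k) (λ v → f (P k + v)))
  sum<-P zero    f = refl
  sum<-P (suc k) f = trans (sum<-split (P k) (p ^ T k) f) (cong (_+ sum< (p ^ T k) (λ v → f (P k + v))) (sum<-P k f))

  P-sum : ∀ k → P k ≡ sum< k (λ k → p ^ T k)
  P-sum zero    = refl
  P-sum (suc k) = cong (_+ p ^ T k) (P-sum k)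

  boxCount≤cells : boxCount ≤ sum< g (λ k → sum< g (λ i → sum< Y (λ j → S k i j)))
  boxCount≤cells = begin
    sum< N (λ n → 𝟙 (inDigitBox? n))
      ≤⟨ sum<-mono N (λ n _ → point-bound n) ⟩
    sum< N (λ n → sum< g (λ i → sum< Y (λ j → 𝟙 (cell? (L * i) (j₀ + L * j) n))))
      ≡⟨ sum<-P g _ ⟩
    sum< g (λ k → sum< (p ^ T k) (λ v → sum< g (λ i → sum< Y (λ j → 𝟙 (cell? (L * i) (j₀ + L * j) (P k + v))))))
      ≡⟨ sum<-cong g (λ k _ → trans (sum<-swap (p ^ T k) g _) (sum<-cong g (λ i _ → sum<-swap (p ^ T k) Y _))) ⟩
    sum< g (λ k → sum< g (λ i → sum< Y (λ j → S k i j))) ∎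
    where
    open ≤-Reasoning
    point-bound : ∀ n → 𝟙 (inDigitBox? n) ≤ sum< g (λ i → sum< Y (λ j → 𝟙 (cell? (L * i) (j₀ + L * j) n)))
    point-bound n = go (inDigitBox? n)
      where
      found : ∃[ i ] ∃[ j ] (i < g × j < Y × Cell (L * i) (j₀ + L * j) n) →
        𝟙 (inDigitBox? n) ≤ sum< g (λ i → sum< Y (λ j → 𝟙 (cell? (L * i) (j₀ + L * j) n)))
      found (i , j , i< , j< , cell) = begin
        𝟙 (inDigitBox? n)                         ≤⟨ 𝟙≤1 (inDigitBox? n) ⟩
        1                                         ≡⟨ 𝟙-yes (cell? (L * i) (j₀ + L * j) n) cell ⟨
        𝟙 (cell? (L * i) (j₀ + L * j) n)          ≤⟨ sum<-term Y j (λ j → 𝟙 (cell? (L * i) (j₀ + L * j) n)) j< ⟩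
        sum< Y (λ j → 𝟙 (cell? (L * i) (j₀ + L * j) n))  ≤⟨ sum<-term g i (λ i → sum< Y (λ j → 𝟙 (cell? (L * i) (j₀ + L * j) n))) i< ⟩
        sum< g (λ i → sum< Y (λ j → 𝟙 (cell? (L * i) (j₀ + L * j) n)))  ∎
      go : Dec (InDigitBox n) →
        𝟙 (inDigitBox? n) ≤ sum< g (λ i → sum< Y (λ j → 𝟙 (cell? (L * i) (j₀ + L * j) n)))
      go (yes box) = found (box⇒cell n box)
      go (no ¬box) = ≤-trans (≤-reflexive (𝟙-no (inDigitBox? n) ¬box)) z≤n

  D≡ : ∀ i j → i < g → j < Y → D ≡ weight L′ g i * weight L′ Y j * p ^ (suc (L * i) + suc (j₀ + L * j))
  D≡ i j i< j< = begin
    p ^ (L * g) * p ^ R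
      ≡⟨ cong₂ _*_ (sym (weight-shift L′ g i i<)) (trans (^-distribˡ-+-* p j₀ (L * Y)) (cong (p ^ j₀ *_) (sym (weight-shift L′ Y j j<)))) ⟩
    x * p ^ suc (L * i) * (p ^ j₀ * (z * p ^ suc (L * j)))
      ≡⟨ lem x (p ^ suc (L * i)) (p ^ j₀) z (p ^ suc (L * j)) ⟩
    x * z * (p ^ suc (L * i) * (p ^ j₀ * p ^ suc (L * j)))
      ≡⟨ cong (λ w → x * z * (p ^ suc (L * i) * w)) (trans (sym (^-distribˡ-+-* p j₀ (suc (L * j)))) (cong (p ^_) (+-suc j₀ (L * j)))) ⟩
    x * z * (p ^ suc (L * i) * p ^ suc (j₀ + L * j))
      ≡⟨ cong (x * z *_) (^-distribˡ-+-* p (suc (L * i)) _) ⟨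
    x * z * p ^ (suc (L * i) + suc (j₀ + L * j)) ∎
    where
    open ≡-Reasoning
    x = weight L′ g i
    z = weight L′ Y j
    lem : ∀ x a b z c → x * a * (b * (z * c)) ≡ x * z * (a * (b * c))
    lem = solve-∀

  -- `D * Q` times the expected number of points of the cell in block `k`.
  share : ℕ → ℕ → ℕ → ℕ
  share k i j = p ^ T k * weight L′ g i * Q * weight L′ Y j

  index-sum : ∀ i j k → L * i + (j₀ + L * j) + L * k ≡ L * (i + j + k) + L * (g + g) + L′
  index-sum i j k = lem L i (L * (g + g)) L′ j k
    where
    lem : ∀ L i x y j k → L * i + (x + y + L * j) + L * k ≡ L * (i + j + k) + x + y
    lem = solve-∀

  T-sum : ∀ k → k < g → T k + L * k ≡ L * (g + g) + L * (g + g) + K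
  T-sum k k<g = trans (T-index (<⇒≤ k<g)) (lem L g K)
    where
    lem : ∀ L g K → L * g + L * (g + g) + K + L * g ≡ L * (g + g) + L * (g + g) + K
    lem = solve-∀

  balanced-share : ∀ k i j → k < g → i < g → j < Y → i + j + k < g + g → S k i j * (D * Q) ≤ share k i j
  balanced-share k i j k< i< j< small = ≤-reflexive (begin
    S k i j * (D * Q)
      ≡⟨ cong (λ d → S k i j * (d * Q)) (D≡ i j i< j<) ⟩
    S k i j * (x * z * e * Q)
      ≡⟨ lem (S k i j) x z e Q ⟩
    S k i j * e * x * Q * z
      ≡⟨ cong (λ w → w * x * Q * z) (cellCount-balanced k (L * i) (j₀ + L * j) (T k ∸ suc (L * i)) k<
           (m+[n∸m]≡n (≤-trans (m≤m+n (suc (L * i)) _) fits)) room) ⟩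
    share k i j ∎)
    where
    open ≡-Reasoning
    x = weight L′ g i
    z = weight L′ Y j
    e = p ^ (suc (L * i) + suc (j₀ + L * j))
    lem : ∀ s x z e q → s * (x * z * e * q) ≡ s * e * x * q * z
    lem = solve-∀
    -- From i + j + k ≤ 2g - 1 the positions sum to at most t + K + 1 - L = t - K - 1.
    fits : suc (L * i) + (j₀ + L * j + K) ≤ T k
    fits = +-cancelʳ-≤ (L * k) _ _ (≤-trans (≤-reflexive (trans (lem′ (L * i) (j₀ + L * j) K (L * k)) (trans
      (cong (λ s → suc (s + K)) (index-sum i j k)) (lem″ (L * (i + j + k)) (L * (g + g)) L′ K))))
      (≤-trans (+-monoˡ-≤ K (+-monoˡ-≤ (L * (g + g)) (≤-trans (≤-reflexive (trans (+-comm (L * (i + j + k)) L) (sym (*-suc L (i + j + k))))) (*-monoʳ-≤ L small))))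
        (≤-reflexive (sym (T-sum k k<)))))
      where
      lem′ : ∀ a b c d → suc a + (b + c) + d ≡ suc (a + b + d + c)
      lem′ = solve-∀
      lem″ : ∀ a b c d → suc (a + b + c + d) ≡ a + suc c + b + d
      lem″ = solve-∀
    room : j₀ + L * j + K ≤ T k ∸ suc (L * i)
    room = ≤-trans (≤-reflexive (sym (m+n∸m≡n (suc (L * i)) _))) (∸-monoˡ-≤ (suc (L * i)) fits)

  no-points : ∀ k i j → k < g → i < g → g + g ≤ i + j + k → S k i j ≡ 0
  no-points k i j k< i< large = cellCount-empty k (L * i) (j₀ + L * j) (T k ∸ L * i) k< i≤ (m+[n∸m]≡n i≤T) room
    where
    i≤ : L * i ≤ L * g
    i≤ = *-monoʳ-≤ L (<⇒≤ i<)
    i≤T : L * i ≤ T k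
    i≤T = ≤-trans i≤ (≤-trans (m≤m+n (L * g) _) (≤-trans (m≤m+n _ K) (m≤m+n H′ _)))
    over : T k + K ≤ L * i + (j₀ + L * j)
    over = +-cancelʳ-≤ (L * k) _ _ (≤-trans (≤-reflexive (trans (lem (T k) K (L * k)) (trans (cong (_+ K) (T-sum k k<)) (+-assoc _ K K))))
      (≤-trans (+-mono-≤ (+-monoˡ-≤ (L * (g + g)) (*-monoʳ-≤ L large)) (n≤1+n (K + K))) (≤-reflexive (sym (index-sum i j k)))))
      where
      lem : ∀ a b c → a + b + c ≡ a + c + b
      lem = solve-∀
    room : T k ∸ L * i + K ≤ j₀ + L * j
    room = +-cancelˡ-≤ (L * i) _ _ (≤-trans (≤-reflexive (trans (sym (+-assoc (L * i) _ K)) (cong (_+ K) (m+[n∸m]≡n i≤T)))) over)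

  share-bound : ∀ k i j → k < g → i < g → j < Y → S k i j * (D * Q) ≤ share k i j
  share-bound k i j k< i< j< = go (i + j + k <? g + g)
    where
    go : Dec (i + j + k < g + g) → S k i j * (D * Q) ≤ share k i j
    go (yes small) = balanced-share k i j k< i< j< small
    go (no ¬small) = ≤-trans (≤-reflexive (cong (_* (D * Q)) (no-points k i j k< i< (≮⇒≥ ¬small)))) z≤n

  -- On the diagonal i + j + k = 2g a cell is empty although its expected number of points is p^{-(K+3)}.
  diagonal-gain : ∀ k i j → k < g → i < g → j < Y → i + j + k ≡ g + g → S k i j * (D * Q) + D ≤ share k i j
  diagonal-gain k i j k< i< j< diag = ≤-reflexive (begin
    S k i j * (D * Q) + D              ≡⟨ cong (λ s → s * (D * Q) + D) (no-points k i j k< i< (≤-reflexive (sym diag))) ⟩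
    D                                  ≡⟨ D≡ i j i< j< ⟩
    x * z * p ^ (suc (L * i) + suc (j₀ + L * j))  ≡⟨ cong (λ e → x * z * p ^ e) exponent ⟩
    x * z * p ^ (T k + (K + 3))        ≡⟨ cong (x * z *_) (^-distribˡ-+-* p (T k) (K + 3)) ⟩
    x * z * (p ^ T k * Q)              ≡⟨ lem x z (p ^ T k) Q ⟩
    share k i j                        ∎)
    where
    open ≡-Reasoning
    x = weight L′ g i
    z = weight L′ Y j
    lem : ∀ x z t q → x * z * (t * q) ≡ t * x * q * z
    lem = solve-∀
    exponent : suc (L * i) + suc (j₀ + L * j) ≡ T k + (K + 3)
    exponent = +-cancelʳ-≡ (L * k) _ _ (begin
      suc (L * i) + suc (j₀ + L * j) + L * k        ≡⟨ lem₁ (L * i) (j₀ + L * j) (L * k) ⟩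
      2 + (L * i + (j₀ + L * j) + L * k)            ≡⟨ cong (2 +_) (index-sum i j k) ⟩
      2 + (L * (i + j + k) + L * (g + g) + L′)      ≡⟨ cong (λ s → 2 + (L * s + L * (g + g) + L′)) diag ⟩
      2 + (L * (g + g) + L * (g + g) + L′)          ≡⟨ lem₂ (L * (g + g) + L * (g + g)) K ⟩
      (L * (g + g) + L * (g + g) + K) + (K + 3)     ≡⟨ cong (_+ (K + 3)) (T-sum k k<) ⟨
      T k + L * k + (K + 3)                         ≡⟨ lem₃ (T k) (L * k) (K + 3) ⟩
      T k + (K + 3) + L * k                         ∎)
      where
      lem₁ : ∀ a b c → suc a + suc b + c ≡ 2 + (a + b + c)
      lem₁ = solve-∀
      lem₂ : ∀ a K → 2 + (a + suc (K + K)) ≡ a + K + (K + 3)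
      lem₂ = solve-∀
      lem₃ : ∀ a b c → a + b + c ≡ a + c + b
      lem₃ = solve-∀

  -- Every pair (k, i) meets the diagonal once, at `j* = 2g − i − k`, so there are g² empty diagonal
  -- cells in all.
  row-gain : ∀ k i → k < g → i < g → sum< Y (λ j → S k i j) * (D * Q) + D ≤ p ^ T k * weight L′ g i * Q * Z
  row-gain k i k< i< = begin
    sum< Y (λ j → S k i j) * (D * Q) + D        ≡⟨ cong (_+ D) (sum<-*ʳ Y (D * Q) _) ⟨
    sum< Y (λ j → S k i j * (D * Q)) + D        ≤⟨ sum<-mono-gain Y j* D j*< (λ j j< → share-bound k i j k< i< j<) (diagonal-gain k i j* k< i< j*< diag) ⟩
    sum< Y (λ j → share k i j)                  ≡⟨ sum<-*ˡ Y (p ^ T k * weight L′ g i * Q) _ ⟩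
    p ^ T k * weight L′ g i * Q * Z             ∎
    where
    open ≤-Reasoning
    j* = g + g ∸ (i + k)
    j*< : j* < Y
    j*< = s≤s (m∸n≤m (g + g) (i + k))
    diag : i + j* + k ≡ g + g
    diag = trans (lem i j* k) (m+[n∸m]≡n (+-mono-≤ (<⇒≤ i<) (<⇒≤ k<)))
      where
      lem : ∀ a b c → a + b + c ≡ a + c + b
      lem = solve-∀

  sum-gain : ∀ n (f : ℕ → ℕ) m D → sum< n f * m + n * D ≡ sum< n (λ k → f k * m + D)
  sum-gain n f m D = sym (trans (sum<-+ n _ _) (cong₂ _+_ (sum<-*ʳ n m f) (sum<-const n D)))

  -- The shares factor in k, i and j, and Σ p^{T k} = N, so they add up to `N * (X * Z) * Q`.
  boxCount-gain : boxCount * (D * Q) + g * (g * D) ≤ N * (X * Z) * Q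
  boxCount-gain = begin
    boxCount * (D * Q) + g * (g * D)
      ≤⟨ +-monoˡ-≤ _ (*-monoˡ-≤ (D * Q) boxCount≤cells) ⟩
    sum< g (λ k → sum< g (λ i → sum< Y (λ j → S k i j))) * (D * Q) + g * (g * D)
      ≡⟨ trans (sum-gain g _ (D * Q) (g * D)) (sum<-cong g (λ k _ → sum-gain g _ (D * Q) D)) ⟩
    sum< g (λ k → sum< g (λ i → sum< Y (λ j → S k i j) * (D * Q) + D))
      ≤⟨ sum<-mono g (λ k k< → sum<-mono g (λ i i< → row-gain k i k< i<)) ⟩
    sum< g (λ k → sum< g (λ i → p ^ T k * weight L′ g i * Q * Z))
      ≡⟨ sum<-cong g (λ k _ → trans (sum<-cong g (λ i _ → lem (p ^ T k) (weight L′ g i) Q Z)) (sum<-*ˡ g (p ^ T k * Q * Z) _)) ⟩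
    sum< g (λ k → p ^ T k * Q * Z * X)
      ≡⟨ trans (sum<-cong g (λ k _ → lem′ (p ^ T k) Q Z X)) (sum<-*ˡ g (X * Z * Q) _) ⟩
    X * Z * Q * sum< g (λ k → p ^ T k)
      ≡⟨ trans (cong (X * Z * Q *_) (sym (P-sum g))) (lem″ (X * Z) Q N) ⟩
    N * (X * Z) * Q ∎
    where
    open ≤-Reasoning
    lem : ∀ t x q z → t * x * q * z ≡ t * q * z * x
    lem = solve-∀
    lem′ : ∀ t q z x → t * q * z * x ≡ x * z * q * t
    lem′ = solve-∀
    lem″ : ∀ y q n → y * q * n ≡ n * y * q
    lem″ = solve-∀

  X≤x-bound : X ≤ x-bound
  X≤x-bound = ≤-trans (m≤n+m X (p ^ (L * g) * 0)) (sparse-lower (digit p W) 0 L′ g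
    (λ i i< → trans (W-low (L * i) (*-monoʳ-< L i<)) (sparse-multiple i)))

  y-width : ℕ
  y-width = y-upper ∸ p ^ (L * Y) * y-lower

  private
    y-lower+Z≤y-upper : p ^ (L * Y) * y-lower + Z ≤ y-upper
    y-lower+Z≤y-upper = sparse-lower (y W) j₀ L′ Y
      (λ j j< → trans (W-y (L * j) (*-monoʳ-< L j<)) (sparse-multiple j))

  y-width-eq : p ^ (L * Y) * y-lower + y-width ≡ y-upper
  y-width-eq = m+[n∸m]≡n (≤-trans (m≤m+n (p ^ (L * Y) * y-lower) Z) y-lower+Z≤y-upper)

  Z≤y-width : Z ≤ y-width
  Z≤y-width = ≤-trans (≤-reflexive (sym (m+n∸m≡n (p ^ (L * Y) * y-lower) Z))) (∸-monoˡ-≤ (p ^ (L * Y) * y-lower) y-lower+Z≤y-upper)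

  -- After division by `D * Q`, the box misses at least g² / p^{K+3} points.
  box-deficit : boxCount * (D * Q) + g * (g * D) ≤ N * (x-bound * y-width) * Q
  box-deficit = ≤-trans boxCount-gain (*-monoˡ-≤ Q (*-monoʳ-≤ N (*-mono-≤ X≤x-bound Z≤y-width)))

-- From the deficit to the discrepancy.

does⇒ : ∀ {ℓ} {P : Set ℓ} (P? : Dec P) → does P? ≡ true → P
does⇒ (yes x) _ = x

p≤∣p∣ : ∀ x → x ℚ.≤ ℚ.∣ x ∣
p≤∣p∣ x with ℚ.≤-total 0ℚ x
... | inj₁ 0≤x = ℚ.≤-reflexive (sym (ℚ.0≤p⇒∣p∣≡p 0≤x))
... | inj₂ x≤0 = ℚ.≤-trans x≤0 (ℚ.0≤∣p∣ x)

+<⇒<∣-∣ : ∀ {c x y} → x ℚ.+ c ℚ.< y → c ℚ.< ℚ.∣ x ℚ.- y ∣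
+<⇒<∣-∣ {c} {x} {y} lt = begin-strict
  c                            ≡⟨ ℚ.+-identityʳ c ⟨
  c ℚ.+ 0ℚ                     ≡⟨ cong (c ℚ.+_) (ℚ.+-inverseʳ x) ⟨
  c ℚ.+ (x ℚ.- x)              ≡⟨ ℚ.+-assoc c x (ℚ.- x) ⟨
  (c ℚ.+ x) ℚ.- x              ≡⟨ cong (ℚ._- x) (ℚ.+-comm c x) ⟩
  (x ℚ.+ c) ℚ.- x              <⟨ ℚ.+-monoˡ-< (ℚ.- x) lt ⟩
  y ℚ.- x                      ≤⟨ p≤∣p∣ (y ℚ.- x) ⟩
  ℚ.∣ y ℚ.- x ∣                ≡⟨ ℚ.∣-p∣≡∣p∣ (y ℚ.- x) ⟨
  ℚ.∣ ℚ.- (y ℚ.- x) ∣          ≡⟨ cong ℚ.∣_∣ (ℚ.neg-distrib-+ y (ℚ.- x)) ⟩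
  ℚ.∣ ℚ.- y ℚ.- (ℚ.- x) ∣      ≡⟨ cong (λ w → ℚ.∣ ℚ.- y ℚ.+ w ∣) (⁻¹-involutive ℚ.+-0-group x) ⟩
  ℚ.∣ ℚ.- y ℚ.+ x ∣            ≡⟨ cong ℚ.∣_∣ (ℚ.+-comm (ℚ.- y) x) ⟩
  ℚ.∣ x ℚ.- y ∣                ∎
  where open ℚ.≤-Reasoning

n<2^n : ∀ n → n < 2 ^ n
n<2^n zero    = z<s
n<2^n (suc n) = begin-strict
  suc n            <⟨ s≤s (n<2^n n) ⟩
  suc (2 ^ n)      ≤⟨ +-monoˡ-≤ (2 ^ n) (m^n>0 2 n) ⟩
  2 ^ n + 2 ^ n    ≡⟨ cong (2 ^ n +_) (sym (+-identityʳ (2 ^ n))) ⟩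
  2 * 2 ^ n        ∎
  where open ≤-Reasoning

module Bound (p : ℕ) .{{_ : NonZero p}} (prime : Prime p) (θ : Laurent p)
  (K : ℕ) (norm-bound : ∀ r Q → NormBound p θ r Q K) where
  open Digits p
  open Prime-Digits p prime
  open Counterexample p prime θ K norm-bound
  open Expansions p

  -- `C₀ * g` bounds log₂ N: N ≤ p^{T 0 + L}, log₂ p ≤ p because p < 2^p, and T 0 + L ≤ (5L + K) g.
  -- The `suc` makes the final inequality strict.
  C₀ denominator : ℕ
  C₀ = p * (5 * suc (suc (K + K)) + K)
  denominator = p ^ (K + 3) * suc (C₀ * C₀)

  instance
    denominator-nonZero : NonZero denominator
    denominator-nonZero = m*n≢0 (p ^ (K + 3)) (suc (C₀ * C₀)) {{m^n≢0 p (K + 3)}}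

  constant : ℚ
  constant = ℤ.+ 1 ℚ./ denominator

  0<constant : 0ℚ ℚ.< constant
  0<constant = ratio-mono-< {0} {1} {1} {denominator} z<s

  module Stage (g : ℕ) (0<g : 0 < g) where
    open Construction p prime θ K norm-bound g public
    open Cells p prime θ K norm-bound g centre public
    open Counting p prime θ K norm-bound g centre public
    open Centre centre

    N-upper : N ≤ p ^ (T 0 + L)
    N-upper = ≤-trans (m≤m+n N _) (P-bound 0 g ≤-refl)

    N-lower : g ≤ N
    N-lower = lem g 0<g ≤-refl
      where
      lem : ∀ k → 0 < k → k ≤ g → g ≤ P k
      lem (suc k) _ k<g = ≤-trans (<⇒≤ (n<p^n g)) (≤-trans (^-mono (≤-trans (m≤n*m g L)
        (≤-trans (m≤m+n (L * g) _) (≤-trans (m≤m+n _ K) (m≤m+n H′ _))))) (m≤n+m _ (P k)))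

    log-bound : ⌊log₂ N ⌋ ≤ C₀ * g
    log-bound = begin
      ⌊log₂ N ⌋                    ≤⟨ ⌊log₂⌋-mono-≤ N-upper ⟩
      ⌊log₂ p ^ (T 0 + L) ⌋        ≤⟨ ⌊log₂⌋-mono-≤ (^-monoˡ-≤ (T 0 + L) (<⇒≤ (n<2^n p))) ⟩
      ⌊log₂ (2 ^ p) ^ (T 0 + L) ⌋  ≡⟨ trans (cong ⌊log₂_⌋ (^-*-assoc 2 p (T 0 + L))) (⌊log₂[2^n]⌋≡n (p * (T 0 + L))) ⟩
      p * (T 0 + L)                ≤⟨ *-monoʳ-≤ p exponent ⟩
      p * ((5 * L + K) * g)        ≡⟨ *-assoc p (5 * L + K) g ⟨
      C₀ * g                       ∎
      where
      open ≤-Reasoning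
      exponent : T 0 + L ≤ (5 * L + K) * g
      exponent = begin
        L * g + L * (g + g) + K + L * g + L          ≤⟨ +-mono-≤ (+-monoˡ-≤ (L * g) (+-monoʳ-≤ (L * g + L * (g + g)) (m≤m*n K g {{>-nonZero 0<g}}))) (m≤m*n L g {{>-nonZero 0<g}}) ⟩
        L * g + L * (g + g) + K * g + L * g + L * g  ≡⟨ lem L g K ⟩
        (5 * L + K) * g                              ∎
        where
        lem : ∀ L g K → L * g + L * (g + g) + K * g + L * g + L * g ≡ (5 * L + K) * g
        lem = solve-∀

    box : Box
    box = record
      { a₁ = 0ℚ ; b₁ = frac x-bound (L * g) ; a₂ = frac y-lower j₀ ; b₂ = frac y-upper R
      ; 0≤a₁ = ℚ.≤-refl ; a₁≤b₁ = 0≤frac x-bound (L * g) ; b₁≤1 = frac≤1 (digit<p W) (L * g)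
      ; 0≤a₂ = 0≤frac y-lower j₀
      ; a₂≤b₂ = ℚ.≤-trans (ℚ.≤-reflexive (frac-shift y-lower j₀ (L * Y)))
                  (frac-mono-≤ {p ^ (L * Y) * y-lower} {R} {y-upper} {R} (*-monoˡ-≤ (p ^ R) (≤-trans (m≤m+n _ y-width) (≤-reflexive y-width-eq))))
      ; b₂≤1 = frac≤1 (y<p W) R }
      where
      frac≤1 : ∀ {d} → (∀ u → d u < p) → ∀ k → frac (val d k) k ℚ.≤ 1ℚ
      frac≤1 {d} d< k = ratio-mono-≤ {val d k} {p ^ k} {1} {1} {{m^n≢0 p k}}
        (≤-trans (≤-reflexive (*-identityʳ (val d k))) (≤-trans (<⇒≤ (val<p^ d< k)) (≤-reflexive (sym (*-identityˡ (p ^ k))))))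

    inBox⇒ : ∀ n → InBox p θ box n → InDigitBox n
    inBox⇒ n ((_ , x<) , (y≥ , y<)) =
      vdc-<⇒ n (<-≤-trans (n<p^n n) (^-mono (n≤1+n n))) {x-bound} {L * g} x< ,
      LeKron⇒ θ n (not-all-pred n) {y-lower} {j₀} y≥ ,
      KronLt⇒ θ n {y-upper} {R} y<

    inBox⇐ : ∀ n → InDigitBox n → InBox p θ box n
    inBox⇐ n (x< , y≥ , y<) =
      (0≤vdc n n< , vdc-<⇐ n n< {x-bound} {L * g} x<) ,
      (LeKron⇐ θ n {y-lower} {j₀} y≥ , KronLt⇐ θ n (not-all-pred n) {y-upper} {R} y<)
      where n< = <-≤-trans (n<p^n n) (^-mono (n≤1+n n))

    indicator : Fin N → Bool
    indicator n = does (inDigitBox? (toℕ n))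

    indicator-correct : IsIndicator p θ box N indicator
    indicator-correct n = (λ e → inBox⇐ (toℕ n) (does⇒ (inDigitBox? (toℕ n)) e))
                        , (λ b → dec-true (inDigitBox? (toℕ n)) (inBox⇒ (toℕ n) b))

    count-indicator : count N indicator ≡ boxCount
    count-indicator = count-toℕ N (λ n → does (inDigitBox? n))

    D-nonZero : NonZero D
    D-nonZero = m*n≢0 (p ^ (L * g)) (p ^ R) {{m^n≢0 p (L * g)}} {{m^n≢0 p R}}

    DQ-nonZero : NonZero (D * Q)
    DQ-nonZero = m*n≢0 D Q {{D-nonZero}} {{m^n≢0 p (K + 3)}}

    box-volume : vol box ≡ (ℤ.+ (x-bound * y-width) ℚ./ D) {{D-nonZero}}
    box-volume = trans (cong₂ ℚ._*_ (ℚ.+-identityʳ (frac x-bound (L * g))) width)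
      (ratio-* x-bound (p ^ (L * g)) y-width (p ^ R) {{m^n≢0 p (L * g)}} {{m^n≢0 p R}} {{D-nonZero}})
      where
      open ≡-Reasoning
      lower = frac (p ^ (L * Y) * y-lower) R
      width : frac y-upper R ℚ.- frac y-lower j₀ ≡ frac y-width R
      width = begin
        frac y-upper R ℚ.- frac y-lower j₀          ≡⟨ cong₂ (λ u l → frac u R ℚ.- l) (trans (sym y-width-eq) (+-comm _ y-width)) (frac-shift y-lower j₀ (L * Y)) ⟩
        frac (y-width + p ^ (L * Y) * y-lower) R ℚ.- lower  ≡⟨ cong (ℚ._- lower) (frac-+ y-width (p ^ (L * Y) * y-lower) R) ⟨
        (frac y-width R ℚ.+ lower) ℚ.- lower        ≡⟨ ℚ.+-assoc (frac y-width R) lower (ℚ.- lower) ⟩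
        frac y-width R ℚ.+ (lower ℚ.- lower)        ≡⟨ cong (frac y-width R ℚ.+_) (ℚ.+-inverseʳ lower) ⟩
        frac y-width R ℚ.+ 0ℚ                       ≡⟨ ℚ.+-identityʳ _ ⟩
        frac y-width R                              ∎

    log-square : 1 * (⌊log₂ N ⌋ * ⌊log₂ N ⌋) * (D * Q) < g * (g * D) * (denominator * 1)
    log-square = begin-strict
      1 * (l * l) * (D * Q)                ≤⟨ *-monoˡ-≤ (D * Q) (≤-trans (≤-reflexive (*-identityˡ (l * l))) (*-mono-≤ log-bound log-bound)) ⟩
      C₀ * g * (C₀ * g) * (D * Q)          ≡⟨ lem₁ C₀ g D Q ⟩
      C₀ * C₀ * (g * g * (D * Q))          <⟨ +-monoˡ-< _ (>-nonZero⁻¹ _ {{m*n≢0 (g * g) (D * Q) {{m*n≢0 g g {{g≢0}} {{g≢0}}}} {{DQ-nonZero}}}}) ⟩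
      suc (C₀ * C₀) * (g * g * (D * Q))    ≡⟨ lem₂ (suc (C₀ * C₀)) g D Q ⟩
      g * (g * D) * (denominator * 1)      ∎
      where
      open ≤-Reasoning
      l = ⌊log₂ N ⌋
      g≢0 : NonZero g
      g≢0 = >-nonZero 0<g
      lem₁ : ∀ c g D Q → c * g * (c * g) * (D * Q) ≡ c * c * (g * g * (D * Q))
      lem₁ = solve-∀
      lem₂ : ∀ s g D Q → s * (g * g * (D * Q)) ≡ g * (g * D) * (Q * s * 1)
      lem₂ = solve-∀

    -- The sign is known: the box contains too few points, so it is enough that the count plus c
    -- log² N stays below N times the volume.
    discrepancy : constant ℚ.* toℚ (⌊log₂ N ⌋ * ⌊log₂ N ⌋) ℚ.< ℚ.∣ toℚ (count N indicator) ℚ.- toℚ N ℚ.* vol box ∣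
    discrepancy = +<⇒<∣-∣ {constant ℚ.* toℚ l²} {toℚ (count N indicator)} {toℚ N ℚ.* vol box} (begin-strict
      toℚ (count N indicator) ℚ.+ constant ℚ.* toℚ l²
        ≡⟨ cong₂ (λ m x → toℚ m ℚ.+ x) count-indicator (ratio-* 1 denominator l² 1 {{denominator-nonZero}} {{_}} {{d1-nonZero}}) ⟩
      toℚ boxCount ℚ.+ (ℤ.+ (1 * l²) ℚ./ (denominator * 1)) {{d1-nonZero}}
        <⟨ ℚ.+-monoʳ-< (toℚ boxCount) (ratio-mono-< {1 * l²} {denominator * 1} {g * (g * D)} {D * Q} {{d1-nonZero}} {{DQ-nonZero}} log-square) ⟩
      toℚ boxCount ℚ.+ (ℤ.+ (g * (g * D)) ℚ./ (D * Q)) {{DQ-nonZero}}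
        ≡⟨ cong (ℚ._+ (ℤ.+ (g * (g * D)) ℚ./ (D * Q)) {{DQ-nonZero}}) (ratio-cross-≡ {boxCount} {1} {boxCount * (D * Q)} {D * Q} {{_}} {{DQ-nonZero}} (sym (*-identityʳ (boxCount * (D * Q))))) ⟩
      (ℤ.+ (boxCount * (D * Q)) ℚ./ (D * Q)) {{DQ-nonZero}} ℚ.+ (ℤ.+ (g * (g * D)) ℚ./ (D * Q)) {{DQ-nonZero}}
        ≡⟨ ratio-+ (boxCount * (D * Q)) (g * (g * D)) (D * Q) {{DQ-nonZero}} ⟩
      (ℤ.+ (boxCount * (D * Q) + g * (g * D)) ℚ./ (D * Q)) {{DQ-nonZero}}
        ≤⟨ ratio-mono-≤ {boxCount * (D * Q) + g * (g * D)} {D * Q} {N * (x-bound * y-width)} {1 * D} {{DQ-nonZero}} {{1D-nonZero}}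
             (≤-trans (*-monoˡ-≤ (1 * D) box-deficit) (≤-reflexive (lem (N * (x-bound * y-width)) Q D))) ⟩
      (ℤ.+ (N * (x-bound * y-width)) ℚ./ (1 * D)) {{1D-nonZero}}
        ≡⟨ ratio-* N 1 (x-bound * y-width) D {{_}} {{D-nonZero}} {{1D-nonZero}} ⟨
      toℚ N ℚ.* (ℤ.+ (x-bound * y-width) ℚ./ D) {{D-nonZero}}
        ≡⟨ cong (toℚ N ℚ.*_) box-volume ⟨
      toℚ N ℚ.* vol box ∎)
      where
      open ℚ.≤-Reasoning
      l² = ⌊log₂ N ⌋ * ⌊log₂ N ⌋
      d1-nonZero : NonZero (denominator * 1)
      d1-nonZero = m*n≢0 denominator 1
      1D-nonZero : NonZero (1 * D)
      1D-nonZero = m*n≢0 1 D {{_}} {{D-nonZero}}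
      lem : ∀ m q d → m * q * (1 * d) ≡ m * (d * q)
      lem = solve-∀

theorem8 : (p : ℕ) .{{_ : NonZero p}} → Prime p →
    (θ : Laurent p) → XadicLittlewoodCounterexample p θ →
    ∃[ c ] (0ℚ ℚ.< c ×
    (∀ (M : ℕ) → ∃[ N ] (M ≤ N × ∃[ J ] ∃[ S ] (IsIndicator p θ J N S ×
    c ℚ.* toℚ (⌊log₂ N ⌋ * ⌊log₂ N ⌋) ℚ.< ℚ.∣ toℚ (count N S) ℚ.- toℚ N ℚ.* vol J ∣))))
theorem8 p p-prime θ (K , norm-bound) = constant , 0<constant , λ M →
  -- The choice g = M + 1 is positive and makes N ≥ g exceed M.
  let open Stage (suc M) z<s in
  N , ≤-trans (n≤1+n M) N-lower , box , indicator , indicator-correct , discrepancy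
  where open Bound p p-prime θ K norm-bound
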